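{- Let $\mathcal{V}=\mathbb{ISP}(\mathcal{C})$ be any variety of residuated lattices such that the class $\mathcal{C}$ is closed under canonical extensions and, for every $n\in\mathbb{N}$, $\mathcal{V}\not\models(\mathrm{e}\wedge x)^{n+1}\approx(\mathrm{e}\wedge x)^n$. Then $\mathcal{V}$ is not coherent, does not admit right uniform deductive interpolation, and its first-order theory does not have a model completion.
   Context: A residuated lattice is an algebra $\langle A,\wedge,\vee,\cdot,\backslash,/,\mathrm{e}\rangle$ such that $\langle A,\wedge,\vee\rangle$ is a lattice, $\langle A,\cdot,\mathrm{e}\rangle$ is a monoid, and $b\le a\backslash c\iff a\cdot b\le c\iff a\le c/b$ for all $a,b,c\in A$. $\mathbb{ISP}(\mathcal{C})$ is the class of isomorphic copies of subalgebras of direct products of members of $\mathcal{C}$. Canonical extensions. A completion of a poset $P$ is a complete lattice $C$ with an order embedding of $P$ into $C$ preserving all existing finite meets and joins; $P$ is identified with its image. An element of $C$ is open (resp. closed) if it is a join (resp. meet) in $C$ of a nonempty subset of $P$; $O$ and $K$ denote the sets of open and closed elements. The completion is dense if every element of $C$ is both a join of closed elements and a meet of open elements; it is compact if for all nonempty $A\subseteq K$, $B\subseteq O$: $\bigwedge A\le\bigvee B$ iff $\bigwedge A_0\le\bigvee B_0$ for some finite nonempty $A_0\subseteq A$, $B_0\subseteq B$. A dense compact completion is called the canonical extension $P^\sigma$ of $P$ (unique up to isomorphism fixing $P$). For $f\colon P^n\to P$, the maps $f^\sigma,f^\pi\colon(P^\sigma)^n\to P^\sigma$ are $$f^\sigma(x)=\bigvee\bigl\{\bigwedge\{f(a)\mid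 a\in P^n,\ p\le a\le q\}\mid p\in K^n,\ q\in O^n,\ p\le x\le q\bigr\},$$ $$f^\pi(x)=\bigwedge\bigl\{\bigvee\{f(a)\mid a\in P^n,\ p\le a\le q\}\mid p\in K^n,\ q\in O^n,\ p\le x\le q\bigr\}.$$ The canonical extension of a residuated lattice $\mathbf{A}$ is $\mathbf{A}^\sigma=\langle A^\sigma,\wedge^\sigma,\vee^\sigma,\cdot^\sigma,\backslash^\pi,/^\pi,\mathrm{e}\rangle$, which is again a residuated lattice. $\mathcal{C}$ is closed under canonical extensions if $\mathbf{A}\in\mathcal{C}$ implies $\mathbf{A}^\sigma\in\mathcal{C}$. $\mathcal{V}$ is coherent if every finitely generated subalgebra of a finitely presented member of $\mathcal{V}$ is finitely presented (finitely presented: isomorphic to a quotient of a finitely generated free algebra of $\mathcal{V}$ by a finitely generated congruence). $\Sigma\models_{\mathcal{V}}\varepsilon$ means that every assignment of the variables into any member of $\mathcal{V}$ satisfying all equations in $\Sigma$ satisfies $\varepsilon$. $\mathcal{V}$ admits right uniform deductive interpolation if for any finite disjoint sets of variables $\overline{x},\overline{y}$ and finite set $\Sigma$ of equations in variables $\overline{x},\overline{y}$, there is a finite set $\Pi$ of equations in variables $\overline{y}$ such that for every equation $\varepsilon$ whose variables lie in $\overline{y}$ and a set $\overline{z}$ disjoint from $\overline{x},\overline{y}$: $\Sigma\models_{\mathcal{V}}\varepsilon\iff\Pi\models_{\mathcal{V}}\varepsilon$. A model completion of a theory $T$ is a theory $T^*\supseteq T$ in the same language such that every model of $T$ embeds into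 a model of $T^*$ and, for every model $M$ of $T$, $T^*$ together with the quantifier-free diagram of $M$ is a complete theory. -}

module Defs where

open import Level using (Level; _⊔_; suc; Lift)
open import Algebra.Core using (Op₂)
open import Algebra.Definitions using (Congruent₂)
open import Algebra.Structures using (IsMonoid)
open import Algebra.Lattice.Structures using (IsLattice)
open import Algebra.Lattice.Bundles using (Lattice)
import Algebra.Lattice.Properties.Lattice as LatticeProperties
open import Data.Empty using (⊥; ⊥-elim)
open import Data.Fin.Base using (Fin)
open import Data.List.Base using (List; map)
open import Data.List.Membership.Propositional using () renaming (_∈_ to _∈ₗ_)
open import Data.List.Relation.Unary.All using (All)
open import Data.Nat.Base using (ℕ; zero) renaming (suc to 1+)
open import Data.Product.Base using (Σ; Σ-syntax; ∃; ∃-syntax; _×_; _,_; proj₁; proj₂)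
import Data.Product.Base as Product
open import Data.Sum.Base using (_⊎_; inj₁; inj₂; [_,_])
import Data.Sum.Base as Sum
open import Data.Unit.Base using (⊤)
open import Data.Vec.Base using (Vec; []; _∷_; lookup)
open import Function.Base using (_∘_)
open import Function.Bundles using (_⇔_)
open import Function.Definitions using (Injective; Surjective; Bijective)
open import Relation.Binary.Bundles using (Poset)
open import Relation.Binary.Core using (Rel)
open import Relation.Binary.Definitions using (_Respects_)
open import Relation.Binary.Morphism.Structures using (IsOrderMonomorphism)
open import Relation.Binary.PropositionalEquality.Core using (_≡_)
open import Relation.Binary.Structures using (IsEquivalence)
open import Relation.Nullary.Negation.Core using (¬_)
open import Relation.Unary using (Pred; _∈_; _⊆_; _∪_; Satisfiable)

private
  variable
    a b c ℓ ℓ₁ ℓ₂ p q x y κ τ : Level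

------------------------------------------------------------------------

data BinOp : Set where
  meet join mult under over : BinOp

-- Algebras are setoid-based: _≈_ plays the role of equality.

record Algebra (c ℓ : Level) : Set (suc (c ⊔ ℓ)) where
  field
    Carrier       : Set c
    _≈_           : Rel Carrier ℓ
    isEquivalence : IsEquivalence _≈_
    op            : BinOp → Op₂ Carrier
    e             : Carrier
    op-cong       : (o : BinOp) → Congruent₂ _≈_ (op o)

  infix  4 _≈_
  infixr 7 _∧_
  infixr 6 _∨_
  infixl 8 _·_
  infix  8 _\\_ _//_

  _∧_ _∨_ _·_ _\\_ _//_ : Op₂ Carrier
  _∧_  = op meet
  _∨_  = op join
  _·_  = op mult
  _\\_ = op under
  _//_ = op over

  open IsEquivalence isEquivalence public
    using () renaming (refl to ≈-refl; sym to ≈-sym; trans to ≈-trans)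

record IsResiduatedLattice {c ℓ : Level} (A : Algebra c ℓ) : Set (c ⊔ ℓ) where
  open Algebra A
  field
    isLattice : IsLattice _≈_ _∨_ _∧_
    isMonoid  : IsMonoid _≈_ _·_ e

  lattice : Lattice c ℓ
  lattice = record { isLattice = isLattice }

  -- x ≤ y is x ≈ x ∧ y.
  poset : Poset c ℓ ℓ
  poset = LatticeProperties.poset lattice

  open Poset poset public using (_≤_)

  field
    residuation-\\ : ∀ a b c → (b ≤ a \\ c) ⇔ (a · b ≤ c)
    residuation-// : ∀ a b c → (a · b ≤ c) ⇔ (a ≤ c // b)

------------------------------------------------------------------------

record Hom {a ℓ₁ b ℓ₂ : Level} (A : Algebra a ℓ₁) (B : Algebra b ℓ₂)
           : Set (a ⊔ ℓ₁ ⊔ b ⊔ ℓ₂) where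
  private
    module A = Algebra A
    module B = Algebra B
  field
    ⟦_⟧     : A.Carrier → B.Carrier
    ⟦⟧-cong : ∀ {x y} → x A.≈ y → ⟦ x ⟧ B.≈ ⟦ y ⟧
    op-homo : ∀ o x y → ⟦ A.op o x y ⟧ B.≈ B.op o ⟦ x ⟧ ⟦ y ⟧
    e-homo  : ⟦ A.e ⟧ B.≈ B.e

module _ {a ℓ₁ b ℓ₂ : Level} (A : Algebra a ℓ₁) (B : Algebra b ℓ₂) where
  private
    module A = Algebra A
    module B = Algebra B

  Embedding : Set (a ⊔ ℓ₁ ⊔ b ⊔ ℓ₂)
  Embedding = Σ[ h ∈ Hom A B ] Injective A._≈_ B._≈_ (Hom.⟦_⟧ h)

  Surjection : Set (a ⊔ ℓ₁ ⊔ b ⊔ ℓ₂)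
  Surjection = Σ[ h ∈ Hom A B ] Surjective A._≈_ B._≈_ (Hom.⟦_⟧ h)

  infix 4 _≅_
  _≅_ : Set (a ⊔ ℓ₁ ⊔ b ⊔ ℓ₂)
  _≅_ = Σ[ h ∈ Hom A B ] Bijective A._≈_ B._≈_ (Hom.⟦_⟧ h)

record Subuniverse {c ℓ : Level} (A : Algebra c ℓ) (p : Level) : Set (c ⊔ ℓ ⊔ suc p) where
  open Algebra A
  field
    mem       : Pred Carrier p
    resp      : mem Respects _≈_
    e-closed  : e ∈ mem
    op-closed : ∀ o {x y} → x ∈ mem → y ∈ mem → op o x y ∈ mem

subalgebra : (A : Algebra c ℓ) → Subuniverse A p → Algebra (c ⊔ p) ℓ
subalgebra A S = record
  { Carrier       = Σ Carrier mem
  ; _≈_           = λ u v → proj₁ u ≈ proj₁ v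
  ; isEquivalence = record { refl = ≈-refl ; sym = ≈-sym ; trans = ≈-trans }
  ; op            = λ o u v → op o (proj₁ u) (proj₁ v) , op-closed o (proj₂ u) (proj₂ v)
  ; e             = e , e-closed
  ; op-cong       = λ o → op-cong o
  }
  where
  open Algebra A
  open Subuniverse S

∏ : (I : Set x) → (I → Algebra c ℓ) → Algebra (x ⊔ c) (x ⊔ ℓ)
∏ I F = record
  { Carrier       = ∀ j → Carrier (F j)
  ; _≈_           = λ u v → ∀ j → _≈_ (F j) (u j) (v j)
  ; isEquivalence = record
    { refl  = λ j → ≈-refl (F j)
    ; sym   = λ u≈v j → ≈-sym (F j) (u≈v j)
    ; trans = λ u≈v v≈w j → ≈-trans (F j) (u≈v j) (v≈w j)
    }
  ; op            = λ o u v j → op (F j) o (u j) (v j)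
  ; e             = λ j → e (F j)
  ; op-cong       = λ o u≈v s≈t j → op-cong (F j) o (u≈v j) (s≈t j)
  }
  where open Algebra

module _ {c ℓ : Level} (A : Algebra c ℓ) {n : ℕ} (g : Fin n → Algebra.Carrier A) where
  open Algebra A

  data Generated : Pred Carrier (c ⊔ ℓ) where
    gen       : ∀ j → g j ∈ Generated
    resp      : Generated Respects _≈_
    e-closed  : e ∈ Generated
    op-closed : ∀ o {x y} → x ∈ Generated → y ∈ Generated → op o x y ∈ Generated

  ⟨_⟩ : Subuniverse A (c ⊔ ℓ)
  ⟨_⟩ = record
    { mem = Generated ; resp = resp ; e-closed = e-closed ; op-closed = op-closed }

module _ {c ℓ : Level} (A : Algebra c ℓ)
         (R : List (Algebra.Carrier A × Algebra.Carrier A)) where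
  open Algebra A

  data Cg : Rel Carrier (c ⊔ ℓ) where
    base  : ∀ {x y} → (x , y) ∈ₗ R → Cg x y
    incl  : ∀ {x y} → x ≈ y → Cg x y
    sym   : ∀ {x y} → Cg x y → Cg y x
    trans : ∀ {x y z} → Cg x y → Cg y z → Cg x z
    cong  : ∀ o {x y u v} → Cg x y → Cg u v → Cg (op o x u) (op o y v)

  quotient : Algebra c (c ⊔ ℓ)
  quotient = record
    { Carrier       = Carrier
    ; _≈_           = Cg
    ; isEquivalence = record { refl = incl ≈-refl ; sym = sym ; trans = trans }
    ; op            = op
    ; e             = e
    ; op-cong       = λ o → cong o
    }

------------------------------------------------------------------------

data Term (X : Set x) : Set x where
  var : X → Term X
  e   : Term X
  op  : BinOp → Term X → Term X → Term X

rename : {X : Set x} {Y : Set y} → (X → Y) → Term X → Term Y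
rename f (var v)    = var (f v)
rename f e          = e
rename f (op o s t) = op o (rename f s) (rename f t)

infixr 9 _^_
_^_ : {X : Set x} → Term X → ℕ → Term X
t ^ zero   = e
t ^ (1+ n) = op mult t (t ^ n)

eval : {X : Set x} (A : Algebra c ℓ) → (X → Algebra.Carrier A) → Term X → Algebra.Carrier A
eval A ρ (var v)    = ρ v
eval A ρ e          = Algebra.e A
eval A ρ (op o s t) = Algebra.op A o (eval A ρ s) (eval A ρ t)

Equation : Set x → Set x
Equation X = Term X × Term X

renameEq : {X : Set x} {Y : Set y} → (X → Y) → Equation X → Equation Y
renameEq f = Product.map (rename f) (rename f)

_,_⊨ₑ_ : {X : Set x} (A : Algebra c ℓ) → (X → Algebra.Carrier A) → Equation X → Set ℓ
A , ρ ⊨ₑ (s , t) = Algebra._≈_ A (eval A ρ s) (eval A ρ t)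

------------------------------------------------------------------------

Class : (ℓ κ : Level) → Set (suc (ℓ ⊔ κ))
Class ℓ κ = Pred (Algebra ℓ ℓ) κ

_⊨_ : {X : Set x} → Class ℓ κ → Equation X → Set (x ⊔ suc ℓ ⊔ κ)
V ⊨ ε = ∀ A → A ∈ V → ∀ ρ → A , ρ ⊨ₑ ε

_⊨[_]_ : {X : Set x} → List (Equation X) → Class ℓ κ → Equation X → Set (x ⊔ suc ℓ ⊔ κ)
Γ ⊨[ V ] ε = ∀ A → A ∈ V → ∀ ρ → All (A , ρ ⊨ₑ_) Γ → A , ρ ⊨ₑ ε

ISP : Class ℓ κ → Class ℓ (suc ℓ ⊔ κ)
ISP {ℓ = ℓ} C A =
  Σ[ I ∈ Set ℓ ] Σ[ F ∈ (I → Algebra ℓ ℓ) ] (∀ j → F j ∈ C) ×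
  (Σ[ S ∈ Subuniverse (∏ I F) ℓ ] A ≅ subalgebra (∏ I F) S)

record IsVariety {ℓ κ : Level} (V : Class ℓ κ) : Set (suc ℓ ⊔ κ) where
  field
    H-closed : ∀ {A B} → A ∈ V → Surjection A B → B ∈ V
    S-closed : ∀ {A} → A ∈ V → (S : Subuniverse A ℓ) → subalgebra A S ∈ V
    P-closed : (I : Set ℓ) (F : I → Algebra ℓ ℓ) → (∀ j → F j ∈ V) → ∏ I F ∈ V

------------------------------------------------------------------------

-- Subsets of a poset with carrier in Set ℓ are predicates valued in Set ℓ.

module _ {c ℓ₁ ℓ₂ : Level} (P : Poset c ℓ₁ ℓ₂) where
  open Poset P

  IsJoin IsMeet : Pred Carrier p → Pred Carrier _
  IsJoin S u = (∀ s → s ∈ S → s ≤ u) × (∀ v → (∀ s → s ∈ S → s ≤ v) → u ≤ v)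
  IsMeet S u = (∀ s → s ∈ S → u ≤ s) × (∀ v → (∀ s → s ∈ S → v ≤ s) → v ≤ u)

  range : {I : Set x} → (I → Carrier) → Pred Carrier (ℓ₁ ⊔ x)
  range f u = ∃[ j ] f j ≈ u

module _ {ℓ : Level} (P : Poset ℓ ℓ ℓ) where
  open Poset P

  IsComplete : Set (suc ℓ)
  IsComplete = (S : Pred Carrier ℓ) → ∃ (IsJoin P S) × ∃ (IsMeet P S)

module _ {ℓ : Level} (P C : Poset ℓ ℓ ℓ) (ι : Poset.Carrier P → Poset.Carrier C) where
  private
    module P = Poset P
    module C = Poset C

  record IsCompletion : Set (suc ℓ) where
    field
      complete         : IsComplete C
      isOrderEmbedding : IsOrderMonomorphism P._≈_ C._≈_ P._≤_ C._≤_ ι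
      -- n = 0 is included: a greatest or least element of P, if there
      -- is one, is preserved.
      preserves-joins  : ∀ {n} (f : Fin n → P.Carrier) u →
                         IsJoin P (range P f) u → IsJoin C (range C (ι ∘ f)) (ι u)
      preserves-meets  : ∀ {n} (f : Fin n → P.Carrier) u →
                         IsMeet P (range P f) u → IsMeet C (range C (ι ∘ f)) (ι u)

  image : Pred P.Carrier p → Pred C.Carrier (ℓ ⊔ p)
  image S u = ∃[ a ] a ∈ S × ι a C.≈ u

  IsOpen IsClosed : Pred C.Carrier (suc ℓ)
  IsOpen   u = Σ[ S ∈ Pred P.Carrier ℓ ] Satisfiable S × IsJoin C (image S) u
  IsClosed u = Σ[ S ∈ Pred P.Carrier ℓ ] Satisfiable S × IsMeet C (image S) u

  IsDense : Set (suc ℓ)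
  IsDense = ∀ u →
    (Σ[ S ∈ Pred C.Carrier ℓ ] S ⊆ IsClosed × IsJoin C S u) ×
    (Σ[ S ∈ Pred C.Carrier ℓ ] S ⊆ IsOpen   × IsMeet C S u)

  FinitelyBelow : Pred C.Carrier ℓ → Pred C.Carrier ℓ → Set ℓ
  FinitelyBelow A B =
    Σ[ m ∈ ℕ ] Σ[ f ∈ (Fin (1+ m) → C.Carrier) ] (∀ j → f j ∈ A) ×
    (Σ[ n ∈ ℕ ] Σ[ g ∈ (Fin (1+ n) → C.Carrier) ] (∀ j → g j ∈ B) ×
    (∃[ u ] ∃[ v ] IsMeet C (range C f) u × IsJoin C (range C g) v × u C.≤ v))

  IsCompact : Set (suc ℓ)
  IsCompact = (A B : Pred C.Carrier ℓ) →
    Satisfiable A → A ⊆ IsClosed → Satisfiable B → B ⊆ IsOpen →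
    ∀ u v → IsMeet C A u → IsJoin C B v → (u C.≤ v) ⇔ FinitelyBelow A B

  record IsCanonicalPosetExtension : Set (suc ℓ) where
    field
      isCompletion : IsCompletion
      isDense      : IsDense
      isCompact    : IsCompact

  -- The elements f(a₁,a₂) of C with pᵢ ≤ aᵢ ≤ qᵢ.
  Values : Op₂ P.Carrier → (p₁ p₂ q₁ q₂ : C.Carrier) → Pred C.Carrier ℓ
  Values f p₁ p₂ q₁ q₂ d = ∃[ a₁ ] ∃[ a₂ ]
    (p₁ C.≤ ι a₁ × ι a₁ C.≤ q₁) × (p₂ C.≤ ι a₂ × ι a₂ C.≤ q₂) × ι (f a₁ a₂) C.≈ d

  Box : (x₁ x₂ p₁ p₂ q₁ q₂ : C.Carrier) → Set (suc ℓ)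
  Box x₁ x₂ p₁ p₂ q₁ q₂ =
    (IsClosed p₁ × IsClosed p₂) × (IsOpen q₁ × IsOpen q₂) ×
    (p₁ C.≤ x₁ × x₁ C.≤ q₁) × (p₂ C.≤ x₂ × x₂ C.≤ q₂)

  -- g = f^σ, respectively g = f^π, for a binary operation f.
  IsSigmaExtension IsPiExtension : Op₂ P.Carrier → Op₂ C.Carrier → Set (suc ℓ)
  IsSigmaExtension f g = ∀ x₁ x₂ →
    IsJoin C (λ d → ∃[ p₁ ] ∃[ p₂ ] ∃[ q₁ ] ∃[ q₂ ]
                Box x₁ x₂ p₁ p₂ q₁ q₂ × IsMeet C (Values f p₁ p₂ q₁ q₂) d)
             (g x₁ x₂)
  IsPiExtension f g = ∀ x₁ x₂ →
    IsMeet C (λ d → ∃[ p₁ ] ∃[ p₂ ] ∃[ q₁ ] ∃[ q₂ ]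
                Box x₁ x₂ p₁ p₂ q₁ q₂ × IsJoin C (Values f p₁ p₂ q₁ q₂) d)
             (g x₁ x₂)

-- B is (a copy of) A^σ, which is determined only up to isomorphism.

record IsCanonicalExtension {ℓ : Level} (A B : Algebra ℓ ℓ) : Set (suc ℓ) where
  private
    module A = Algebra A
    module B = Algebra B
  field
    isRL-A : IsResiduatedLattice A
    isRL-B : IsResiduatedLattice B
  private
    P = IsResiduatedLattice.poset isRL-A
    C = IsResiduatedLattice.poset isRL-B
  field
    ι           : A.Carrier → B.Carrier
    isCanonical : IsCanonicalPosetExtension P C ι
    ∧-sigma     : IsSigmaExtension P C ι A._∧_  B._∧_
    ∨-sigma     : IsSigmaExtension P C ι A._∨_  B._∨_
    ·-sigma     : IsSigmaExtension P C ι A._·_  B._·_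
    \\-pi      : IsPiExtension    P C ι A._\\_ B._\\_
    //-pi       : IsPiExtension    P C ι A._//_ B._//_
    e-image     : B.e B.≈ ι A.e

-- The class need not be closed under isomorphism, so it is only
-- required that some copy of A^σ belongs to the class.

ClosedUnderCanonicalExtensions : Class ℓ κ → Set (suc ℓ ⊔ κ)
ClosedUnderCanonicalExtensions C = ∀ A → A ∈ C → ∃[ B ] B ∈ C × IsCanonicalExtension A B

------------------------------------------------------------------------

-- The free algebra of V over X: terms modulo the equations valid in V.

Free : Class ℓ κ → Set x → Algebra x (x ⊔ suc ℓ ⊔ κ)
Free V X = record
  { Carrier       = Term X
  ; _≈_           = λ s t → V ⊨ (s , t)
  ; isEquivalence = record
    { refl  = λ A _ _ → Algebra.≈-refl A
    ; sym   = λ p A A∈V ρ → Algebra.≈-sym A (p A A∈V ρ)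
    ; trans = λ p q A A∈V ρ → Algebra.≈-trans A (p A A∈V ρ) (q A A∈V ρ)
    }
  ; op            = op
  ; e             = e
  ; op-cong       = λ o p q A A∈V ρ → Algebra.op-cong A o (p A A∈V ρ) (q A A∈V ρ)
  }

FinitelyPresented : Class ℓ κ → Algebra c p → Set (suc ℓ ⊔ κ ⊔ c ⊔ p)
FinitelyPresented V A =
  Σ[ n ∈ ℕ ] Σ[ R ∈ List (Equation (Fin n)) ] A ≅ quotient (Free V (Fin n)) R

Coherent : Class ℓ κ → Set (suc ℓ ⊔ κ)
Coherent V = ∀ A → A ∈ V → FinitelyPresented V A →
  ∀ n (g : Fin n → Algebra.Carrier A) → FinitelyPresented V (subalgebra A (⟨_⟩ A g))

------------------------------------------------------------------------

-- The pairwise disjoint variable sets x̄, ȳ, z̄ are Fin m, Fin n, Fin k.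

RightUniformDeductiveInterpolation : Class ℓ κ → Set (suc ℓ ⊔ κ)
RightUniformDeductiveInterpolation V =
  ∀ m n (Γ : List (Equation (Fin m ⊎ Fin n))) →
  Σ[ Π ∈ List (Equation (Fin n)) ]
  (∀ k (ε : Equation (Fin n ⊎ Fin k)) →
    (map (renameEq (Sum.map₂ inj₁)) Γ ⊨[ V ] renameEq (inj₂ {A = Fin m}) ε) ⇔
    (map (renameEq inj₁) Π ⊨[ V ] ε))

------------------------------------------------------------------------

-- P is a set of additional constant symbols; Fin n are the free variables.
-- The remaining connectives and ∃ are classically definable.

data Formula (P : Set p) : ℕ → Set p where
  _≐_ : ∀ {n} → Term (P ⊎ Fin n) → Term (P ⊎ Fin n) → Formula P n
  ⊥̇   : ∀ {n} → Formula P n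
  _⇒̇_ : ∀ {n} → Formula P n → Formula P n → Formula P n
  ∀̇_  : ∀ {n} → Formula P (1+ n) → Formula P n

¬̇_ : {P : Set p} {n : ℕ} → Formula P n → Formula P n
¬̇ φ = φ ⇒̇ ⊥̇

Sentence : Set p → Set p
Sentence P = Formula P 0

mapConst : {P : Set p} {Q : Set q} {n : ℕ} → (P → Q) → Formula P n → Formula Q n
mapConst f (s ≐ t) = rename (Sum.map₁ f) s ≐ rename (Sum.map₁ f) t
mapConst f ⊥̇       = ⊥̇
mapConst f (φ ⇒̇ ψ) = mapConst f φ ⇒̇ mapConst f ψ
mapConst f (∀̇ φ)   = ∀̇ (mapConst f φ)

QuantifierFree : {P : Set p} {n : ℕ} → Pred (Formula P n) _
QuantifierFree (s ≐ t) = ⊤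
QuantifierFree ⊥̇       = ⊤
QuantifierFree (φ ⇒̇ ψ) = QuantifierFree φ × QuantifierFree ψ
QuantifierFree (∀̇ φ)   = ⊥

-- γ interprets the constants.
module _ {ℓ p : Level} (A : Algebra ℓ ℓ) {P : Set p} (γ : P → Algebra.Carrier A) where
  open Algebra A using (Carrier; _≈_)

  Sat : {n : ℕ} → Vec Carrier n → Formula P n → Set ℓ
  Sat ρ (s ≐ t) = eval A [ γ , lookup ρ ] s ≈ eval A [ γ , lookup ρ ] t
  Sat ρ ⊥̇       = Lift ℓ ⊥
  Sat ρ (φ ⇒̇ ψ) = Sat ρ φ → Sat ρ ψ
  Sat ρ (∀̇ φ)   = ∀ u → Sat (u ∷ ρ) φ

Theory : Set p → (τ : Level) → Set (p ⊔ suc τ)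
Theory P τ = Pred (Sentence P) τ

IsModel : {P : Set p} → Theory P τ → (A : Algebra ℓ ℓ) → (P → Algebra.Carrier A) → Set (p ⊔ τ ⊔ ℓ)
IsModel T A γ = ∀ φ → φ ∈ T → Sat A γ [] φ

Entails : (ℓ : Level) {P : Set p} → Theory P τ → Sentence P → Set (p ⊔ τ ⊔ suc ℓ)
Entails ℓ T φ = ∀ (A : Algebra ℓ ℓ) γ → IsModel T A γ → Sat A γ [] φ

IsCompleteTheory : (ℓ : Level) {P : Set p} → Theory P τ → Set (p ⊔ τ ⊔ suc ℓ)
IsCompleteTheory ℓ T = ∀ φ → Entails ℓ T φ ⊎ Entails ℓ T (¬̇ φ)

PureTheory : (τ : Level) → Set (suc τ)
PureTheory τ = Theory ⊥ τ

infix 4 _⊨ᵀ_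
_⊨ᵀ_ : Algebra ℓ ℓ → PureTheory τ → Set (τ ⊔ ℓ)
A ⊨ᵀ T = IsModel T A ⊥-elim

expand : (P : Set p) → PureTheory τ → Theory P (p ⊔ τ)
expand P T φ = ∃[ ψ ] ψ ∈ T × φ ≡ mapConst ⊥-elim ψ

diagram : (M : Algebra ℓ ℓ) → Theory (Algebra.Carrier M) ℓ
diagram M φ = QuantifierFree φ × Sat M (λ u → u) [] φ

-- Models range over the same universe as the algebras of a Class ℓ κ.

IsModelCompletion : (ℓ : Level) → PureTheory τ → PureTheory τ → Set (τ ⊔ suc ℓ)
IsModelCompletion ℓ T T* =
  T ⊆ T* ×
  (∀ (A : Algebra ℓ ℓ) → A ⊨ᵀ T → Σ[ B ∈ Algebra ℓ ℓ ] B ⊨ᵀ T* × Embedding A B) ×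
  (∀ (M : Algebra ℓ ℓ) → M ⊨ᵀ T →
    IsCompleteTheory ℓ (expand (Algebra.Carrier M) T* ∪ diagram M))

HasModelCompletion : (ℓ : Level) → PureTheory τ → Set (suc τ ⊔ suc ℓ)
HasModelCompletion {τ} ℓ T = Σ[ T* ∈ PureTheory τ ] IsModelCompletion ℓ T T*

Th : Class ℓ κ → PureTheory (suc ℓ ⊔ κ)
Th V φ = ∀ A → A ∈ V → Sat A ⊥-elim [] φ

{-# OPTIONS --safe #-}

-- Consider the system y ≤ e, y ≤ (e ∧ x) · y, z ≤ y. Each of its solutions
-- satisfies z ≤ (e ∧ x)ᵏ for all k. Conversely, if this holds in A ∈ V, then A
-- embeds into a product of canonical extensions of members of C, where
-- y = ⋀ₖ (e ∧ x)ᵏ solves the system: compactness gives y ≤ (e ∧ x) · y. So the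
-- consequences of the system in x and z are axiomatised by the inequalities
-- z ≤ (e ∧ x)ᵏ and, as the powers do not stabilise, by no finite set of
-- equations. Interpolation would provide such a finite set, and so would a
-- finite presentation of the subalgebra generated by x and z in the algebra
-- presented by the system.
--
-- Given a model completion T*, extend the algebra presented by z ≤ (e ∧ x)ᵏ to
-- a model Kₖ of T*; the system has no solution there, since z ≰ (e ∧ x)ᵏ⁺¹. An
-- ultraproduct of the Kₖ is a model of T* without solution that extends the
-- algebra M presented by all the inequalities. But M also extends to a model
-- of T* with a solution, so T* together with the diagram of M is not complete.

module Submission where

open import Defs
open import Algebra.Core using (Op₂)
open import Algebra.Definitions using (Congruent₂)
open import Algebra.Structures using (module IsMonoid)
import Algebra.Lattice.Properties.Lattice as LatticeProperties
open import Axiom.ExcludedMiddle using (ExcludedMiddle)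
open import Data.Empty using (⊥; ⊥-elim)
open import Data.Fin.Base using (Fin; zero) renaming (suc to 1+ᶠ)
open import Data.List.Base using (List; []; _∷_; map; foldr)
open import Data.List.Membership.Propositional using () renaming (_∈_ to _∈ₗ_)
open import Data.List.Relation.Unary.All using (All; []; _∷_)
import Data.List.Relation.Unary.All as All
import Data.List.Relation.Unary.All.Properties as All
open import Data.List.Relation.Unary.Any using (here; there)
open import Data.Nat.Base using (ℕ; zero; _+_; _≤_; _≤′_; ≤′-refl; ≤′-step; z≤n; s≤s)
  renaming (suc to 1+; _⊔_ to _⊔ⁿ_)
import Data.Nat.Properties as ℕ
open import Data.Product.Base using (Σ-syntax; ∃; ∃-syntax; _×_; _,_; proj₁; proj₂)
open import Data.Sum.Base using (_⊎_; inj₁; inj₂; [_,_])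
import Data.Sum.Base as Sum
open import Data.Unit.Base using (⊤; tt)
open import Data.Vec.Base using (Vec; []; _∷_; lookup)
open import Function.Base using (_∘_; id; const)
open import Function.Bundles using (module Equivalence)
open import Level using (Level; Lift; lift; lower; _⊔_; suc)
open import Relation.Binary.Bundles using (Poset)
open import Relation.Binary.Core using (Rel)
open import Relation.Binary.Lattice using (module IsLattice)
open import Relation.Binary.Morphism.Structures using (module IsOrderMonomorphism)
open import Relation.Binary.PropositionalEquality.Core as ≡ using (_≡_)
open import Relation.Binary.Structures using (IsEquivalence)
open import Relation.Nullary.Decidable using (yes; no; True; toWitness; fromWitness; map′)
open import Relation.Nullary.Negation.Core using (¬_)
open import Relation.Unary using (Pred; _∈_; _⊆_; _∩_; _∪_; ∁)
open Algebra using (Carrier)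

private
  variable
    a b c ℓ ℓ₁ ℓ₂ κ τ : Level
    X Y : Set a

-- Terms

module _ (A : Algebra c ℓ) where
  open Algebra A using (_≈_; ≈-refl; op-cong)

  power : Carrier A → ℕ → Carrier A
  power d zero   = Algebra.e A
  power d (1+ n) = Algebra._·_ A d (power d n)

  eval-^ : (ρ : X → Carrier A) (t : Term X) (n : ℕ) → eval A ρ (t ^ n) ≡ power (eval A ρ t) n
  eval-^ ρ t zero   = ≡.refl
  eval-^ ρ t (1+ n) = ≡.cong (Algebra._·_ A (eval A ρ t)) (eval-^ ρ t n)

  eval-rename : (ρ : Y → Carrier A) (f : X → Y) (t : Term X) →
                eval A ρ (rename f t) ≡ eval A (ρ ∘ f) t
  eval-rename ρ f (var v)    = ≡.refl
  eval-rename ρ f e          = ≡.refl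
  eval-rename ρ f (op o s t) = ≡.cong₂ (Algebra.op A o) (eval-rename ρ f s) (eval-rename ρ f t)

  eval-cong : {ρ σ : X → Carrier A} → (∀ v → ρ v ≈ σ v) → ∀ t → eval A ρ t ≈ eval A σ t
  eval-cong p (var v)    = p v
  eval-cong p e          = ≈-refl
  eval-cong p (op o s t) = op-cong o (eval-cong p s) (eval-cong p t)

  reflexive : {u v : Carrier A} → u ≡ v → u ≈ v
  reflexive ≡.refl = ≈-refl

  ⊨ₑ-cong : {ρ σ : X → Carrier A} → (∀ v → ρ v ≈ σ v) → ∀ ε → A , ρ ⊨ₑ ε → A , σ ⊨ₑ ε
  ⊨ₑ-cong p (s , t) q =
    ≈-trans (≈-sym (eval-cong p s)) (≈-trans q (eval-cong p t))
    where open Algebra A using (≈-sym; ≈-trans)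

subst : (X → Term Y) → Term X → Term Y
subst σ (var v)    = σ v
subst σ e          = e
subst σ (op o s t) = op o (subst σ s) (subst σ t)

eval-subst : (A : Algebra c ℓ) (ρ : Y → Carrier A) (σ : X → Term Y) (t : Term X) →
             eval A ρ (subst σ t) ≡ eval A (eval A ρ ∘ σ) t
eval-subst A ρ σ (var v)    = ≡.refl
eval-subst A ρ σ e          = ≡.refl
eval-subst A ρ σ (op o s t) = ≡.cong₂ (Algebra.op A o) (eval-subst A ρ σ s) (eval-subst A ρ σ t)

module _ {A : Algebra a ℓ₁} {B : Algebra b ℓ₂} (h : Hom A B) where
  open Hom h
  open Algebra B using (_≈_; ≈-refl; ≈-sym; ≈-trans; op-cong)

  eval-hom : (ρ : X → Carrier A) (t : Term X) → ⟦ eval A ρ t ⟧ ≈ eval B (⟦_⟧ ∘ ρ) t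
  eval-hom ρ (var v)    = ≈-refl
  eval-hom ρ e          = e-homo
  eval-hom ρ (op o s t) = ≈-trans (op-homo o _ _) (op-cong o (eval-hom ρ s) (eval-hom ρ t))

  ⊨ₑ-hom : (ρ : X → Carrier A) (ε : Equation X) → A , ρ ⊨ₑ ε → B , ⟦_⟧ ∘ ρ ⊨ₑ ε
  ⊨ₑ-hom ρ (s , t) q = ≈-trans (≈-sym (eval-hom ρ s)) (≈-trans (⟦⟧-cong q) (eval-hom ρ t))

⊨ₑ-embedding : {A : Algebra a ℓ₁} {B : Algebra b ℓ₂} ((h , _) : Embedding A B)
               (ρ : X → Carrier A) (ε : Equation X) → B , Hom.⟦_⟧ h ∘ ρ ⊨ₑ ε → A , ρ ⊨ₑ ε
⊨ₑ-embedding {B = B} (h , inj) ρ (s , t) q =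
  inj (≈-trans (eval-hom h ρ s) (≈-trans q (≈-sym (eval-hom h ρ t))))
  where open Algebra B using (≈-sym; ≈-trans)

_∘ₕ_ : {A : Algebra a ℓ₁} {B : Algebra b ℓ₂} {C : Algebra c ℓ} → Hom B C → Hom A B → Hom A C
_∘ₕ_ {C = C} g f = record
  { ⟦_⟧     = λ u → Hom.⟦ g ⟧ (Hom.⟦ f ⟧ u)
  ; ⟦⟧-cong = λ q → Hom.⟦⟧-cong g (Hom.⟦⟧-cong f q)
  ; op-homo = λ o u v → ≈-trans (Hom.⟦⟧-cong g (Hom.op-homo f o u v)) (Hom.op-homo g o _ _)
  ; e-homo  = ≈-trans (Hom.⟦⟧-cong g (Hom.e-homo f)) (Hom.e-homo g)
  }
  where open Algebra C using (≈-trans)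

_∘ₑ_ : {A : Algebra a ℓ₁} {B : Algebra b ℓ₂} {C : Algebra c ℓ} →
       Embedding B C → Embedding A B → Embedding A C
(g , g-inj) ∘ₑ (f , f-inj) = g ∘ₕ f , λ q → f-inj (g-inj q)

-- The system of inequalities and the bounds it implies

infix 6 _≤ᵗ_
_≤ᵗ_ : Term X → Term X → Equation X
s ≤ᵗ t = s , op meet s t

_↓ : Term X → Term X
t ↓ = op meet e t

system : (x y z : Term X) → List (Equation X)
system x y z = y ≤ᵗ e ∷ y ≤ᵗ op mult (x ↓) y ∷ z ≤ᵗ y ∷ []

pair : {A : Set a} → A → A → Fin 2 → A
pair u v zero = u
pair u v (1+ᶠ _) = v

pair-η : (A : Algebra c ℓ) (ρ : Fin 2 → Carrier A) → ∀ v → Algebra._≈_ A (pair (ρ zero) (ρ (1+ᶠ zero)) v) (ρ v)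
pair-η A ρ zero       = Algebra.≈-refl A
pair-η A ρ (1+ᶠ zero) = Algebra.≈-refl A

-- The first variable stands for x, the second for z.
bound : ℕ → Equation (Fin 2)
bound k = var (1+ᶠ zero) ≤ᵗ (var zero ↓) ^ k

module _ (A : Algebra c ℓ) where
  open Algebra A using (_≈_; _∧_; _·_) renaming (e to 𝟏)

  infix 4 _⊑_
  _⊑_ : Rel (Carrier A) ℓ
  u ⊑ v = u ≈ u ∧ v

  Solution : (x y z : Carrier A) → Set ℓ
  Solution x y z = (y ⊑ 𝟏) × (y ⊑ (𝟏 ∧ x) · y) × (z ⊑ y)

  Bounded : (x z : Carrier A) → ℕ → Set ℓ
  Bounded x z k = z ⊑ power A (𝟏 ∧ x) k

  ⊨bound : ∀ {ρ : Fin 2 → Carrier A} k → Bounded (ρ zero) (ρ (1+ᶠ zero)) k → A , ρ ⊨ₑ bound k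
  ⊨bound {ρ} k = ≡.subst (λ d → ρ (1+ᶠ zero) ⊑ d) (≡.sym (eval-^ A ρ (var zero ↓) k))

  ⊨bound⁻ : ∀ {ρ : Fin 2 → Carrier A} k → A , ρ ⊨ₑ bound k → Bounded (ρ zero) (ρ (1+ᶠ zero)) k
  ⊨bound⁻ {ρ} k = ≡.subst (λ d → ρ (1+ᶠ zero) ⊑ d) (eval-^ A ρ (var zero ↓) k)

Bounded-hom : {A : Algebra a ℓ₁} {B : Algebra b ℓ₂} (h : Hom A B) → ∀ {u v} k →
              Bounded A u v k → Bounded B (Hom.⟦_⟧ h u) (Hom.⟦_⟧ h v) k
Bounded-hom {A = A} {B} h {u} {v} k q =
  ⊨bound⁻ B k (⊨ₑ-hom h (pair u v) (bound k) (⊨bound A {ρ = pair u v} k q))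

Solution-hom : {A : Algebra a ℓ₁} {B : Algebra b ℓ₂} (h : Hom A B) → ∀ {u v w} →
               Solution A u v w → Solution B (Hom.⟦_⟧ h u) (Hom.⟦_⟧ h v) (Hom.⟦_⟧ h w)
Solution-hom {A = A} {B} h {u} {v} {w} (p , q , r) =
  hom (var zero ≤ᵗ e) p ,
  hom (var zero ≤ᵗ op mult (var (1+ᶠ zero) ↓) (var zero)) q ,
  ⊨ₑ-hom h (pair v w) (var (1+ᶠ zero) ≤ᵗ var zero) r
  where
  hom : ∀ ε → A , pair v u ⊨ₑ ε → B , Hom.⟦_⟧ h ∘ pair v u ⊨ₑ ε
  hom = ⊨ₑ-hom h (pair v u)

-- Residuated lattices

module ResiduatedLattice {A : Algebra c ℓ} (isRL : IsResiduatedLattice A) where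
  open Algebra A using (_∧_; _·_) renaming (e to 𝟏)
  open IsResiduatedLattice isRL using (isMonoid; poset; lattice; residuation-\\; residuation-//)
  open Poset poset public using ()
    renaming (refl to ⊑-refl; trans to ⊑-trans; antisym to ⊑-antisym; reflexive to ⊑-reflexive)
  open IsMonoid isMonoid using (identityˡ)

  ·-monoʳ : ∀ {u v} w → _⊑_ A u v → _⊑_ A (w · u) (w · v)
  ·-monoʳ w q = Equivalence.to (residuation-\\ _ _ _)
    (⊑-trans q (Equivalence.from (residuation-\\ _ _ _) ⊑-refl))

  ·-monoˡ : ∀ {u v} w → _⊑_ A u v → _⊑_ A (u · w) (v · w)
  ·-monoˡ w q = Equivalence.from (residuation-// _ _ _)
    (⊑-trans q (Equivalence.to (residuation-// _ _ _) ⊑-refl))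

  module _ {d : Carrier A} (d⊑e : _⊑_ A d 𝟏) where

    power-step : ∀ n → _⊑_ A (power A d (1+ n)) (power A d n)
    power-step n = ⊑-trans (·-monoˡ _ d⊑e) (⊑-reflexive (identityˡ _))

    power-anti : ∀ {m n} → m ≤′ n → _⊑_ A (power A d n) (power A d m)
    power-anti ≤′-refl     = ⊑-refl
    power-anti {n = 1+ n} (≤′-step q) = ⊑-trans (power-step n) (power-anti q)

  e∧-⊑ : ∀ u → _⊑_ A (𝟏 ∧ u) 𝟏
  e∧-⊑ u = IsLattice.x∧y≤x (LatticeProperties.∨-∧-isOrderTheoreticLattice lattice) 𝟏 u

  -- By induction on `k`, `v` lies below every power: it lies below the unit, and `v ⊑ (𝟏 ∧ u) · v`
  -- turns a bound by one power into a bound by the next.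
  Solution⇒Bounded : ∀ {u v w} → Solution A u v w → ∀ k → Bounded A u w k
  Solution⇒Bounded {u} {v} (p , q , r) k = ⊑-trans r (below k)
    where
    below : ∀ k → _⊑_ A v (power A (𝟏 ∧ u) k)
    below zero   = p
    below (1+ k) = ⊑-trans q (·-monoʳ _ (below k))

  Bounded-anti : ∀ {u w m n} → m ≤ n → Bounded A u w n → Bounded A u w m
  Bounded-anti {u} m≤n q = ⊑-trans q (power-anti (e∧-⊑ u) (ℕ.≤⇒≤′ m≤n))

-- Canonical extensions

finite-bound : ∀ {n} (f : Fin n → ℕ) → ∃[ k ] ∀ j → f j ≤ k
finite-bound {zero} f = 0 , λ ()
finite-bound {1+ n} f with finite-bound (λ j → f (1+ᶠ j))
... | k , f≤k = f zero ⊔ⁿ k , λ where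
  zero     → ℕ.m≤m⊔n _ k
  (1+ᶠ j) → ℕ.≤-trans (f≤k j) (ℕ.m≤n⊔m (f zero) k)

module _ {ℓ : Level} {P C : Poset ℓ ℓ ℓ} {ι : Poset.Carrier P → Poset.Carrier C}
         (isCanonical : IsCanonicalPosetExtension P C ι) where
  private
    module P = Poset P
    module C = Poset C
  open IsCanonicalPosetExtension isCanonical
  open IsCompletion isCompletion
  open IsOrderMonomorphism isOrderEmbedding
    renaming (cong to ι-cong; mono to ι-mono; cancel to ι-cancel; injective to ι-injective)

  singleton-meet : ∀ {u v} → ι u C.≈ v → IsMeet C (image P C ι (P._≈ u)) v
  singleton-meet q =
    (λ s (_ , b≈u , ιb≈s) →
      C.reflexive (C.Eq.trans (C.Eq.sym q) (C.Eq.trans (ι-cong (P.Eq.sym b≈u)) ιb≈s))) ,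
    (λ w below → below _ (_ , P.Eq.refl , q))

  singleton-join : ∀ {u v} → ι u C.≈ v → IsJoin C (image P C ι (P._≈ u)) v
  singleton-join q =
    (λ s (_ , b≈u , ιb≈s) →
      C.reflexive (C.Eq.sym (C.Eq.trans (C.Eq.sym q) (C.Eq.trans (ι-cong (P.Eq.sym b≈u)) ιb≈s)))) ,
    (λ w above → above _ (_ , P.Eq.refl , q))

  ι-closed : ∀ {u v} → ι u C.≈ v → IsClosed P C ι v
  ι-closed {u} q = (P._≈ u) , (u , P.Eq.refl) , singleton-meet q

  ι-open : ∀ {u v} → ι u C.≈ v → IsOpen P C ι v
  ι-open {u} q = (P._≈ u) , (u , P.Eq.refl) , singleton-join q

  point-box : ∀ u v → Box P C ι (ι u) (ι v) (ι u) (ι v) (ι u) (ι v)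
  point-box u v =
    (ι-closed C.Eq.refl , ι-closed C.Eq.refl) , (ι-open C.Eq.refl , ι-open C.Eq.refl) ,
    (C.refl , C.refl) , (C.refl , C.refl)

  module _ {f : Op₂ P.Carrier} (f-cong : Congruent₂ P._≈_ f) where

    values-at-point : ∀ {u v d} → d ∈ Values P C ι f (ι u) (ι v) (ι u) (ι v) → d C.≈ ι (f u v)
    values-at-point (u′ , v′ , (p , p′) , (q , q′) , r) =
      C.Eq.trans (C.Eq.sym r) (ι-cong (f-cong
        (ι-injective (C.antisym p′ p)) (ι-injective (C.antisym q′ q))))

    value-in-box : ∀ {x₁ x₂ p₁ p₂ q₁ q₂} u v → x₁ C.≈ ι u → x₂ C.≈ ι v →
                   Box P C ι x₁ x₂ p₁ p₂ q₁ q₂ →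
                   ι (f u v) ∈ Values P C ι f p₁ p₂ q₁ q₂
    value-in-box u v p q (_ , _ , (r , r′) , (s , s′)) =
      u , v , (C.trans r (C.reflexive p) , C.trans (C.reflexive (C.Eq.sym p)) r′) ,
      (C.trans s (C.reflexive q) , C.trans (C.reflexive (C.Eq.sym q)) s′) , C.Eq.refl

    -- The box whose corners are the point itself contributes `ι (f u v)` to the join. Every other
    -- box around the point has `ι (f u v)` among its values, so its meet lies below.
    sigma-extends : ∀ {g} → IsSigmaExtension P C ι f g → ∀ u v → ι (f u v) C.≈ g (ι u) (ι v)
    sigma-extends sig u v = C.antisym
      (proj₁ (sig (ι u) (ι v)) _ (_ , _ , _ , _ , point-box u v ,
        (λ d d∈ → C.reflexive (C.Eq.sym (values-at-point d∈))) ,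
        (λ w below → below _ (value-in-box u v C.Eq.refl C.Eq.refl (point-box u v)))))
      (proj₂ (sig (ι u) (ι v)) _ λ d (_ , _ , _ , _ , box , glb) →
        proj₁ glb _ (value-in-box u v C.Eq.refl C.Eq.refl box))

    pi-extends : ∀ {g} → IsPiExtension P C ι f g → ∀ u v → ι (f u v) C.≈ g (ι u) (ι v)
    pi-extends pi u v = C.antisym
      (proj₂ (pi (ι u) (ι v)) _ λ d (_ , _ , _ , _ , box , lub) →
        proj₁ lub _ (value-in-box u v C.Eq.refl C.Eq.refl box))
      (proj₁ (pi (ι u) (ι v)) _ (_ , _ , _ , _ , point-box u v ,
        (λ d d∈ → C.reflexive (values-at-point d∈)) ,
        (λ w above → above _ (value-in-box u v C.Eq.refl C.Eq.refl (point-box u v)))))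

  -- Compactness replaces the meet of the whole chain by a meet of finitely many members. As the
  -- chain decreases, a member whose index bounds theirs lies below all of them.
  compact-chain : (d : ℕ → P.Carrier) → (∀ {m n} → m ≤ n → d n P.≤ d m) →
                  ∀ {u} → IsMeet C (image P C ι (λ v → ∃[ k ] d k P.≈ v)) u →
                  ∀ {v} → u C.≤ ι v → ∃[ k ] d k P.≤ v
  compact-chain d anti {u} glb {v} u≤v
    with Equivalence.to (isCompact (image P C ι (λ v → ∃[ k ] d k P.≈ v)) (image P C ι (P._≈ v))
           (ι (d 0) , d 0 , (0 , P.Eq.refl) , C.Eq.refl) (λ (_ , _ , q) → ι-closed q)
           (ι v , v , P.Eq.refl , C.Eq.refl) (λ (_ , _ , q) → ι-open q)
           u (ι v) glb (singleton-join C.Eq.refl)) u≤v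
  ... | m , f , f∈ , n , g , g∈ , s , t , s-meet , t-join , s≤t =
    k , ι-cancel (C.trans (proj₂ s-meet _ dk≤f) (C.trans s≤t (proj₂ t-join _ g≤v)))
    where
    bounded = finite-bound (λ j → proj₁ (proj₁ (proj₂ (f∈ j))))
    k = proj₁ bounded
    dk≤f : ∀ w → w ∈ range C f → ι (d k) C.≤ w
    dk≤f w (j , fj≈w) with f∈ j | proj₂ bounded j
    ... | b , (i , di≈b) , ιb≈fj | i≤k =
      C.trans (ι-mono (anti i≤k)) (C.reflexive (C.Eq.trans (ι-cong di≈b) (C.Eq.trans ιb≈fj fj≈w)))
    g≤v : ∀ w → w ∈ range C g → w C.≤ ι v
    g≤v w (j , gj≈w) with g∈ j
    ... | b , b≈v , ιb≈gj =
      C.reflexive (C.Eq.sym (C.Eq.trans (ι-cong (P.Eq.sym b≈v)) (C.Eq.trans ιb≈gj gj≈w)))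

module CanonicalExtension {ℓ : Level} {A B : Algebra ℓ ℓ} (canonical : IsCanonicalExtension A B) where
  private
    module A = Algebra A
    module B = Algebra B
  open IsCanonicalExtension canonical
  private
    module R = ResiduatedLattice isRL-A
    P = IsResiduatedLattice.poset isRL-A
    C = IsResiduatedLattice.poset isRL-B
    module P = Poset P
    module C = Poset C
  open IsCanonicalPosetExtension isCanonical
  open IsCompletion isCompletion
  open IsOrderMonomorphism isOrderEmbedding renaming (cong to ι-cong; mono to ι-mono; injective to ι-injective)

  embedding : Embedding A B
  embedding = record
    { ⟦_⟧     = ι
    ; ⟦⟧-cong = ι-cong
    ; op-homo = λ where
        meet  → sigma-extends isCanonical (A.op-cong meet) ∧-sigma
        join  → sigma-extends isCanonical (A.op-cong join) ∨-sigma
        mult  → sigma-extends isCanonical (A.op-cong mult) ·-sigma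
        under → pi-extends isCanonical (A.op-cong under) \\-pi
        over  → pi-extends isCanonical (A.op-cong over) //-pi
    ; e-homo  = B.≈-sym e-image
    } , ι-injective

  -- The witness is the meet of all powers of `A.e A.∧ x`, so it depends on `x` alone and lies above
  -- `ι z` for every `z` that satisfies all the bounds.
  solution : ∀ x → ∃[ y ] ∀ z → (∀ k → Bounded A x z k) → Solution B (ι x) y (ι z)
  solution x = y , λ z z⊑ → y⊑e , y⊑xy , proj₂ y-meet (ι z) λ w (b , (k , dk≈b) , ιb≈w) →
      C.trans (ι-mono (z⊑ k)) (C.reflexive (B.≈-trans (ι-cong dk≈b) ιb≈w))
    where
    d = A.e A.∧ x
    Powers : Pred A.Carrier ℓ
    Powers v = ∃[ k ] power A d k P.≈ v
    y = proj₁ (proj₂ (complete (image P C ι Powers)))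
    y-meet = proj₂ (proj₂ (complete (image P C ι Powers)))
    y≤power : ∀ k → y C.≤ ι (power A d k)
    y≤power k = proj₁ y-meet _ (_ , (k , P.Eq.refl) , C.Eq.refl)
    y⊑e = C.trans (y≤power 0) (C.reflexive (B.≈-sym e-image))
    y-closed : IsClosed P C ι y
    y-closed = Powers , (_ , 0 , P.Eq.refl) , y-meet
    -- The box with lower corners `ι d` and `y` and upper corners `ι d` and `ι A.e` surrounds the
    -- point `(ι d , y)`. The meet of its values is one of the elements joined in the sigma
    -- extension, hence lies below `ι d B.· y`.
    products = Values P C ι A._·_ (ι d) y (ι d) (ι A.e)
    product-meet = proj₂ (complete products)
    -- Compactness puts some power of `d`, with exponent `k` say, below `b`. So `y` lies below the
    -- power with exponent `1+ k`, which lies below `d · b` and thus below `d′ · b`.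
    y≤product : ∀ w → w ∈ products → y C.≤ w
    y≤product w (d′ , b , (d≤d′ , _) , (y≤b , _) , w≈)
      with compact-chain isCanonical (power A d)
             (λ m≤n → R.power-anti (R.e∧-⊑ x) (ℕ.≤⇒≤′ m≤n)) y-meet y≤b
    ... | k , dk≤b = C.trans (y≤power (1+ k)) (C.trans
            (ι-mono (P.trans (R.·-monoʳ d dk≤b) (R.·-monoˡ b (cancel d≤d′)))) (C.reflexive w≈))
    y⊑xy : y C.≤ (B.e B.∧ ι x) B.· y
    y⊑xy = C.trans (proj₂ (proj₂ product-meet) y y≤product) (C.trans
      (proj₁ (·-sigma (ι d) y) _ (_ , _ , _ , _ ,
        ((ι-closed isCanonical C.Eq.refl , y-closed) , (ι-open isCanonical C.Eq.refl , ι-open isCanonical C.Eq.refl) ,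
         (C.refl , C.refl) , (C.refl , y≤power 0)) , proj₂ product-meet))
      (C.reflexive (B.op-cong mult (B.≈-trans (Hom.op-homo (proj₁ embedding) meet A.e x)
        (B.op-cong meet (B.≈-sym e-image) B.≈-refl)) B.≈-refl)))

-- Varieties

inclusion : (A : Algebra a ℓ₁) (S : Subuniverse A b) → Embedding (subalgebra A S) A
inclusion A S = record
  { ⟦_⟧     = proj₁
  ; ⟦⟧-cong = id
  ; op-homo = λ _ _ _ → Algebra.≈-refl A
  ; e-homo  = Algebra.≈-refl A
  } , id

Generated-eval : (A : Algebra c ℓ) {n : ℕ} (g : Fin n → Carrier A) → ∀ {u} → Generated A g u →
                 ∃[ t ] Algebra._≈_ A (eval A g t) u
Generated-eval A g (gen j) = var j , Algebra.≈-refl A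
Generated-eval A g (resp u≈v p) with Generated-eval A g p
... | t , q = t , Algebra.≈-trans A q u≈v
Generated-eval A g e-closed = e , Algebra.≈-refl A
Generated-eval A g (op-closed o p q) with Generated-eval A g p | Generated-eval A g q
... | s , s≈ | t , t≈ = op o s t , Algebra.op-cong A o s≈ t≈

∏-power : (I : Set a) (F : I → Algebra c ℓ) (d : Carrier (∏ I F)) (k : ℕ) (j : I) →
          power (∏ I F) d k j ≡ power (F j) (d j) k
∏-power I F d zero   j = ≡.refl
∏-power I F d (1+ k) j = ≡.cong (Algebra._·_ (F j) (d j)) (∏-power I F d k j)

module _ (A : Algebra c ℓ) (ρ : Y → Carrier A) where

  module _ (f : X → Y) where

    ⊨ₑ-rename : ∀ ε → A , ρ ∘ f ⊨ₑ ε → A , ρ ⊨ₑ renameEq f ε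
    ⊨ₑ-rename (s , t) = ≡.subst₂ (Algebra._≈_ A) (≡.sym (eval-rename A ρ f s)) (≡.sym (eval-rename A ρ f t))

    ⊨ₑ-rename⁻ : ∀ ε → A , ρ ⊨ₑ renameEq f ε → A , ρ ∘ f ⊨ₑ ε
    ⊨ₑ-rename⁻ (s , t) = ≡.subst₂ (Algebra._≈_ A) (eval-rename A ρ f s) (eval-rename A ρ f t)

  module _ (σ : X → Term Y) where

    ⊨ₑ-subst⁻ : ∀ s t → A , ρ ⊨ₑ (subst σ s , subst σ t) → A , eval A ρ ∘ σ ⊨ₑ (s , t)
    ⊨ₑ-subst⁻ s t = ≡.subst₂ (Algebra._≈_ A) (eval-subst A ρ σ s) (eval-subst A ρ σ t)

module Variety {ℓ κ : Level} (em : ExcludedMiddle (suc ℓ ⊔ κ)) {V : Class ℓ κ} (variety : IsVariety V) where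
  open IsVariety variety

  -- Excluded middle makes a large proposition small, by recording only the outcome of its decision.
  -- Validity in `V` quantifies over algebras and is too large to be the equality of an algebra of
  -- level `ℓ`.
  Shrink : Set (suc ℓ ⊔ κ) → Set ℓ
  Shrink P = Lift ℓ (True (em {P}))

  shrink : {P : Set (suc ℓ ⊔ κ)} → P → Shrink P
  shrink p = lift (fromWitness p)

  unshrink : {P : Set (suc ℓ ⊔ κ)} → Shrink P → P
  unshrink s = toWitness (lower s)

  module _ {n : ℕ} where

    Refutation : Equation (Fin n) → Set (suc ℓ ⊔ κ)
    Refutation ε = Σ[ A ∈ Algebra ℓ ℓ ] A ∈ V × Σ[ ρ ∈ (Fin n → Carrier A) ] ¬ (A , ρ ⊨ₑ ε)

    ¬Refutation⇒valid : ∀ ε → ¬ Refutation ε → V ⊨ ε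
    ¬Refutation⇒valid ε ¬r A A∈V ρ with em {Lift (suc ℓ ⊔ κ) (A , ρ ⊨ₑ ε)}
    ... | yes p = lower p
    ... | no ¬p with () ← ¬r (A , A∈V , ρ , λ p → ¬p (lift p))

    module _ (_~_ : Rel (Term (Fin n)) (suc ℓ ⊔ κ)) (isEq : IsEquivalence _~_)
             (~-cong : ∀ o {s t u v} → s ~ t → u ~ v → op o s u ~ op o t v) where

      Quotient : Algebra ℓ ℓ
      Quotient = record
        { Carrier       = Lift ℓ (Term (Fin n))
        ; _≈_           = λ s t → Shrink (lower s ~ lower t)
        ; isEquivalence = record
          { refl  = shrink (IsEquivalence.refl isEq)
          ; sym   = λ p → shrink (IsEquivalence.sym isEq (unshrink p))
          ; trans = λ p q → shrink (IsEquivalence.trans isEq (unshrink p) (unshrink q))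
          }
        ; op            = λ o s t → lift (op o (lower s) (lower t))
        ; e             = lift e
        ; op-cong       = λ o p q → shrink (~-cong o (unshrink p) (unshrink q))
        }

      Quotient-eval : ∀ t → eval Quotient (lift ∘ var) t ≡ lift t
      Quotient-eval (var v)    = ≡.refl
      Quotient-eval e          = ≡.refl
      Quotient-eval (op o s t) = ≡.cong₂ (Algebra.op Quotient o) (Quotient-eval s) (Quotient-eval t)

      Quotient-⊨ : ∀ s t → s ~ t → Quotient , lift ∘ var ⊨ₑ (s , t)
      Quotient-⊨ s t p = ≡.subst₂ (Algebra._≈_ Quotient)
        (≡.sym (Quotient-eval s)) (≡.sym (Quotient-eval t)) (shrink p)

      Quotient-⊨⁻ : ∀ s t → Quotient , lift ∘ var ⊨ₑ (s , t) → s ~ t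
      Quotient-⊨⁻ s t p = unshrink (≡.subst₂ (Algebra._≈_ Quotient) (Quotient-eval s) (Quotient-eval t) p)

      -- The terms act faithfully on the product of one refuting valuation for
      -- each refutable equation, and there are few enough equations for this
      -- product to exist at level ℓ.
      Quotient∈V : (∀ {s t} → V ⊨ (s , t) → s ~ t) → Quotient ∈ V
      Quotient∈V valid⇒~ = H-closed (S-closed (P-closed I F F∈V) termFunctions) (toQuotient , onto)
        where
        I : Set ℓ
        I = Σ[ ε ∈ Equation (Fin n) ] Shrink (Refutation ε)
        F : I → Algebra ℓ ℓ
        F (_ , r) = proj₁ (unshrink r)
        F∈V : ∀ j → F j ∈ V
        F∈V (_ , r) = proj₁ (proj₂ (unshrink r))
        valuation : ∀ j → Fin n → Carrier (F j)
        valuation (_ , r) = proj₁ (proj₂ (proj₂ (unshrink r)))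
        Represents : Term (Fin n) → Carrier (∏ I F) → Set ℓ
        Represents t u = ∀ j → Algebra._≈_ (F j) (eval (F j) (valuation j) t) (u j)
        termFunctions : Subuniverse (∏ I F) ℓ
        termFunctions = record
          { mem       = λ u → ∃[ t ] Represents t u
          ; resp      = λ u≈v (t , r) → t , λ j → Algebra.≈-trans (F j) (r j) (u≈v j)
          ; e-closed  = e , λ j → Algebra.≈-refl (F j)
          ; op-closed = λ o (s , q) (t , r) → op o s t , λ j → Algebra.op-cong (F j) o (q j) (r j)
          }
        -- A refutation of `(s , t)` would itself be an index of the product, and the coordinate
        -- there would separate the tuples represented by `s` and `t`.
        unique : ∀ {s t u v} → Represents s u → Represents t v → Algebra._≈_ (∏ I F) u v → V ⊨ (s , t)
        unique {s} {t} q r u≈v = ¬Refutation⇒valid (s , t) λ ref →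
          let j : I
              j = (s , t) , shrink ref
          in proj₂ (proj₂ (proj₂ (unshrink (proj₂ j))))
               (Algebra.≈-trans (F j) (q j) (Algebra.≈-trans (F j) (u≈v j) (Algebra.≈-sym (F j) (r j))))
        toQuotient : Hom (subalgebra (∏ I F) termFunctions) Quotient
        toQuotient = record
          { ⟦_⟧     = λ (_ , t , _) → lift t
          ; ⟦⟧-cong = λ { {_ , s , q} {_ , t , r} u≈v → shrink (valid⇒~ (unique {s} {t} q r u≈v)) }
          ; op-homo = λ _ _ _ → Algebra.≈-refl Quotient
          ; e-homo  = Algebra.≈-refl Quotient
          }
        onto : ∀ t → ∃ λ u → ∀ {v} → Algebra._≈_ (subalgebra (∏ I F) termFunctions) v u →
               Algebra._≈_ Quotient (Hom.⟦ toQuotient ⟧ v) t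
        onto (lift t) = ((λ j → eval (F j) (valuation j) t) , t , λ j → Algebra.≈-refl (F j)) ,
          λ { {_ , s , q} v≈ → shrink (valid⇒~ (unique {s} {t} q (λ j → Algebra.≈-refl (F j)) v≈)) }

  Cg-sound : ∀ {A n} {Γ : List (Equation (Fin n))} → A ∈ V → (ρ : Fin n → Carrier A) → All (A , ρ ⊨ₑ_) Γ →
             ∀ {s t} → Cg (Free V (Fin n)) Γ s t → A , ρ ⊨ₑ (s , t)
  Cg-sound A∈V ρ ps (base m)      = All.lookup ps m
  Cg-sound {A} A∈V ρ ps (incl q)  = q A A∈V ρ
  Cg-sound {A} A∈V ρ ps (sym q)   = Algebra.≈-sym A (Cg-sound A∈V ρ ps q)
  Cg-sound {A} A∈V ρ ps (trans q r) = Algebra.≈-trans A (Cg-sound A∈V ρ ps q) (Cg-sound A∈V ρ ps r)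
  Cg-sound {A} A∈V ρ ps (cong o q r) = Algebra.op-cong A o (Cg-sound A∈V ρ ps q) (Cg-sound A∈V ρ ps r)

quotient-eval : (V : Class ℓ κ) {n m : ℕ} (R : List (Equation (Fin n))) (σ : Fin m → Term (Fin n)) (t : Term (Fin m)) →
                eval (quotient (Free V (Fin n)) R) σ t ≡ subst σ t
quotient-eval V R σ (var v)    = ≡.refl
quotient-eval V R σ e          = ≡.refl
quotient-eval V R σ (op o s t) = ≡.cong₂ (op o) (quotient-eval V R σ s) (quotient-eval V R σ t)

subst-var : {n : ℕ} (t : Term (Fin n)) → subst var t ≡ t
subst-var (var v)    = ≡.refl
subst-var e          = ≡.refl
subst-var (op o s t) = ≡.cong₂ (op o) (subst-var s) (subst-var t)

-- Algebras presented by the bounds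

module Main {ℓ κ : Level} (em : ExcludedMiddle (suc ℓ ⊔ κ)) (C : Class ℓ κ)
            (variety : IsVariety (ISP C)) (V⊆RL : ISP C ⊆ IsResiduatedLattice)
            (canonical : ClosedUnderCanonicalExtensions C) where

  V : Class ℓ (suc ℓ ⊔ κ)
  V = ISP C

  open Variety em {V} variety public

  products∈V : (I : Set ℓ) (F : I → Algebra ℓ ℓ) → (∀ j → F j ∈ C) → ∏ I F ∈ V
  products∈V I F F∈C = I , F , F∈C , everything , record
    { ⟦_⟧     = λ u → u , lift tt
    ; ⟦⟧-cong = id
    ; op-homo = λ _ _ _ → Algebra.≈-refl (∏ I F)
    ; e-homo  = Algebra.≈-refl (∏ I F)
    } ,
    id , λ (u , _) → u , id
    where
    everything : Subuniverse (∏ I F) ℓ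
    everything = record
      { mem       = λ _ → Lift ℓ ⊤
      ; resp      = λ _ _ → lift tt
      ; e-closed  = lift tt
      ; op-closed = λ _ _ _ → lift tt
      }

  -- `A` embeds into a product of members of `C`, and each factor into its canonical extension. The
  -- system is solved in each factor separately, and the product of the extensions is again in `V`.
  solution-in-extension : ∀ {A} → A ∈ V → ∀ {x z} → (∀ k → Bounded A x z k) →
    Σ[ B ∈ Algebra ℓ ℓ ] B ∈ V × Σ[ (h , _) ∈ Embedding A B ]
    ∃[ y ] Solution B (Hom.⟦ h ⟧ x) y (Hom.⟦ h ⟧ z)
  solution-in-extension {A} (I , F , F∈C , S , A≅S) {x} {z} bounded =
    ∏ I B , products∈V I B B∈C , h , (λ j → proj₁ (solves j)) ,
    (λ j → proj₁ (solved j)) , (λ j → proj₁ (proj₂ (solved j))) , (λ j → proj₂ (proj₂ (solved j)))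
    where
    B : I → Algebra ℓ ℓ
    B j = proj₁ (canonical (F j) (F∈C j))
    B∈C : ∀ j → B j ∈ C
    B∈C j = proj₁ (proj₂ (canonical (F j) (F∈C j)))
    module E j = CanonicalExtension (proj₂ (proj₂ (canonical (F j) (F∈C j))))
    ∏ι : Embedding (∏ I F) (∏ I B)
    ∏ι = record
      { ⟦_⟧     = λ u j → Hom.⟦ proj₁ (E.embedding j) ⟧ (u j)
      ; ⟦⟧-cong = λ q j → Hom.⟦⟧-cong (proj₁ (E.embedding j)) (q j)
      ; op-homo = λ o u v j → Hom.op-homo (proj₁ (E.embedding j)) o (u j) (v j)
      ; e-homo  = λ j → Hom.e-homo (proj₁ (E.embedding j))
      } , λ q j → proj₂ (E.embedding j) (q j)
    f : Embedding A (∏ I F)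
    f = inclusion (∏ I F) S ∘ₑ (proj₁ A≅S , proj₁ (proj₂ A≅S))
    h : Embedding A (∏ I B)
    h = ∏ι ∘ₑ f
    solves : ∀ j → _
    solves j = E.solution j (Hom.⟦ proj₁ f ⟧ x j)
    solved : ∀ j → Solution (B j) _ (proj₁ (solves j)) _
    solved j = proj₂ (solves j) (Hom.⟦ proj₁ f ⟧ z j) λ k →
      ≡.subst (_⊑_ (F j) (Hom.⟦ proj₁ f ⟧ z j)) (∏-power I F _ k j) (Bounded-hom (proj₁ f) k (bounded k) j)

  Solution⇒⊨bound : ∀ {A} → A ∈ V → ∀ {x y z} → Solution A x y z → ∀ k → A , pair x z ⊨ₑ bound k
  Solution⇒⊨bound {A} A∈V sol k = ⊨bound A k (ResiduatedLattice.Solution⇒Bounded (V⊆RL A∈V) sol k)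

  -- One bound suffices as premise, since it implies all bounds with smaller exponents.
  infix 4 _⊢_
  _⊢_ : ℕ → Equation (Fin 2) → Set (suc ℓ ⊔ κ)
  k ⊢ ε = (bound k ∷ []) ⊨[ V ] ε

  ⊢-bound : ∀ k → k ⊢ bound k
  ⊢-bound k A A∈V ρ (p ∷ []) = p

  ⊢-mono : ∀ {m n} → m ≤ n → ∀ ε → m ⊢ ε → n ⊢ ε
  ⊢-mono {m} {n} m≤n ε q A A∈V ρ (p ∷ []) = q A A∈V ρ
    (⊨bound A m (ResiduatedLattice.Bounded-anti (V⊆RL A∈V) m≤n (⊨bound⁻ A n p)) ∷ [])

  -- Substitute the power itself for z.
  ⊢bound⇒stable : ∀ k → k ⊢ bound (1+ k) → V ⊨ ((var {X = ⊤} tt ↓) ^ 1+ k , (var tt ↓) ^ k)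
  ⊢bound⇒stable k k⊢ A A∈V ρ = ≡.subst₂ (Algebra._≈_ A)
    (≡.sym (eval-^ A ρ (var tt ↓) (1+ k))) (≡.sym (eval-^ A ρ (var tt ↓) k))
    (⊑-antisym (power-step d⊑e k) (⊨bound⁻ A {ρ = σ} (1+ k)
      (k⊢ A A∈V σ (⊨bound A {ρ = σ} k ⊑-refl ∷ []))))
    where
    open ResiduatedLattice (V⊆RL A∈V)
    d = Algebra._∧_ A (Algebra.e A) (ρ tt)
    d⊑e = e∧-⊑ (ρ tt)
    σ : Fin 2 → Carrier A
    σ = pair (ρ tt) (power A d k)

  -- The algebra presented in `V` by two generators and the relation `bound k`; its congruence is
  -- the consequence relation itself.
  module Stage (k : ℕ) where

    _~_ : Rel (Term (Fin 2)) (suc ℓ ⊔ κ)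
    s ~ t = k ⊢ (s , t)

    ~-isEquivalence : IsEquivalence _~_
    ~-isEquivalence = record
      { refl  = λ A _ _ _ → Algebra.≈-refl A
      ; sym   = λ p A A∈V ρ ps → Algebra.≈-sym A (p A A∈V ρ ps)
      ; trans = λ p q A A∈V ρ ps → Algebra.≈-trans A (p A A∈V ρ ps) (q A A∈V ρ ps)
      }

    ~-cong : ∀ o {s t u v} → s ~ t → u ~ v → op o s u ~ op o t v
    ~-cong o p q A A∈V ρ ps = Algebra.op-cong A o (p A A∈V ρ ps) (q A A∈V ρ ps)

    algebra : Algebra ℓ ℓ
    algebra = Quotient _~_ ~-isEquivalence ~-cong

    algebra∈V : algebra ∈ V
    algebra∈V = Quotient∈V _~_ ~-isEquivalence ~-cong λ p A A∈V ρ _ → p A A∈V ρ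

    ⊨⇔⊢ : ∀ ε → (k ⊢ ε → algebra , lift ∘ var ⊨ₑ ε) × (algebra , lift ∘ var ⊨ₑ ε → k ⊢ ε)
    ⊨⇔⊢ (s , t) = Quotient-⊨ _~_ ~-isEquivalence ~-cong s t , Quotient-⊨⁻ _~_ ~-isEquivalence ~-cong s t

  -- The algebra presented by all the bounds. Its congruence is the increasing union of those of the
  -- stages, so each equation true of the generators is already a consequence of a single bound.
  module Limit where

    _~_ : Rel (Term (Fin 2)) (suc ℓ ⊔ κ)
    s ~ t = ∃[ k ] k ⊢ (s , t)

    ~-isEquivalence : IsEquivalence _~_
    ~-isEquivalence = record
      { refl  = 0 , λ A _ _ _ → Algebra.≈-refl A
      ; sym   = λ { {s} {t} (k , p) → k , IsEquivalence.sym (Stage.~-isEquivalence k) {s} {t} p }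
      ; trans = λ { {s} {t} {u} (m , p) (n , q) → m ⊔ⁿ n ,
          IsEquivalence.trans (Stage.~-isEquivalence (m ⊔ⁿ n)) {s} {t} {u}
            (⊢-mono (ℕ.m≤m⊔n m n) (s , t) p) (⊢-mono (ℕ.m≤n⊔m m n) (t , u) q) }
      }

    ~-cong : ∀ o {s t u v} → s ~ t → u ~ v → op o s u ~ op o t v
    ~-cong o {s} {t} {u} {v} (m , p) (n , q) = m ⊔ⁿ n ,
      Stage.~-cong (m ⊔ⁿ n) o {s} {t} {u} {v}
        (⊢-mono (ℕ.m≤m⊔n m n) (s , t) p) (⊢-mono (ℕ.m≤n⊔m m n) (u , v) q)

    algebra : Algebra ℓ ℓ
    algebra = Quotient _~_ ~-isEquivalence ~-cong

    algebra∈V : algebra ∈ V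
    algebra∈V = Quotient∈V _~_ ~-isEquivalence ~-cong λ p → 0 , λ A A∈V ρ _ → p A A∈V ρ

    ⊨⇔⊢ : ∀ ε → (∃[ k ] k ⊢ ε → algebra , lift ∘ var ⊨ₑ ε) × (algebra , lift ∘ var ⊨ₑ ε → ∃[ k ] k ⊢ ε)
    ⊨⇔⊢ (s , t) = Quotient-⊨ _~_ ~-isEquivalence ~-cong s t , Quotient-⊨⁻ _~_ ~-isEquivalence ~-cong s t

    x z : Carrier algebra
    x = lift (var zero)
    z = lift (var (1+ᶠ zero))

    bounded : ∀ k → Bounded algebra x z k
    bounded k = ⊨bound⁻ algebra k (proj₁ (⊨⇔⊢ (bound k)) (k , ⊢-bound k))

    extension : Σ[ B ∈ Algebra ℓ ℓ ] B ∈ V × Σ[ (h , _) ∈ Embedding algebra B ]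
                ∃[ y ] Solution B (Hom.⟦ h ⟧ x) y (Hom.⟦ h ⟧ z)
    extension = solution-in-extension algebra∈V bounded

  finitely-many : ∀ Π → (∀ ε → ε ∈ₗ Π → ∃[ k ] k ⊢ ε) → ∃[ k ] All (k ⊢_) Π
  finitely-many []      f = 0 , []
  finitely-many (ε ∷ Π) f with f ε (here ≡.refl) | finitely-many Π (λ δ δ∈Π → f δ (there δ∈Π))
  ... | m , p | n , ps = m ⊔ⁿ n ,
    ⊢-mono (ℕ.m≤m⊔n m n) ε p ∷ All.map (λ {δ} → ⊢-mono (ℕ.m≤n⊔m m n) δ) ps

  -- Failure of finite axiomatisation and of interpolation

  module _ (unbounded : ∀ k → ¬ (k ⊢ bound (1+ k))) where

    -- The limit algebra embeds into an algebra with a solution, so `Π` holds at its generators.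
    -- Each of the finitely many equations follows from some bound, hence all of them from one
    -- `bound k`; by completeness this entails `bound (1+ k)`, contrary to `unbounded`.
    no-finite-axiomatisation : (Π : List (Equation (Fin 2))) →
      (∀ {A} → A ∈ V → ∀ {x y z} → Solution A x y z → All (A , pair x z ⊨ₑ_) Π) →
      ¬ (∀ k → Π ⊨[ V ] bound k)
    no-finite-axiomatisation Π sound complete = unbounded k λ A A∈V ρ ps →
      complete (1+ k) A A∈V ρ (All.map (λ p → p A A∈V ρ ps) k⊢Π)
      where
      open Limit
      B = proj₁ extension
      h = proj₁ (proj₂ (proj₂ extension))
      B⊨Π : All (B , pair _ _ ⊨ₑ_) Π
      B⊨Π = sound (proj₁ (proj₂ extension)) (proj₂ (proj₂ (proj₂ (proj₂ extension))))
      finite : ∃[ k ] All (k ⊢_) Π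
      finite = finitely-many Π λ ε ε∈Π → proj₂ (⊨⇔⊢ ε) (⊨ₑ-embedding h (lift ∘ var) ε
        (⊨ₑ-cong B (pair-η B (Hom.⟦ proj₁ h ⟧ ∘ lift ∘ var)) ε (All.lookup B⊨Π ε∈Π)))
      k = proj₁ finite
      k⊢Π = proj₂ finite

    ¬interpolation : ¬ RightUniformDeductiveInterpolation V
    ¬interpolation interpolation
      -- The one variable to be eliminated is the y of the system; x and z are kept.
      with interpolation 1 2 (system (var (inj₂ zero)) (var (inj₁ zero)) (var (inj₂ (1+ᶠ zero))))
    ... | Π , interpolates = no-finite-axiomatisation Π sound complete
      where
      -- Each equation of `Π` follows from `Π`, so by interpolation from the system. Conversely,
      -- every bound follows from the system and does not mention y, so it follows from `Π`. The set
      -- of fresh variables is empty both times.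
      sound : ∀ {A} → A ∈ V → ∀ {x y z} → Solution A x y z → All (A , pair x z ⊨ₑ_) Π
      sound {A} A∈V {x} {y} {z} (p , q , r) = All.tabulate λ {ε} ε∈Π →
        ⊨ₑ-rename⁻ A (ρ ∘ inj₂) inj₁ ε (⊨ₑ-rename⁻ A ρ inj₂ (renameEq inj₁ ε)
          (Equivalence.from (interpolates 0 (renameEq inj₁ ε))
            (λ _ _ _ ps → All.lookup (All.map⁻ ps) ε∈Π)
            A A∈V ρ (p ∷ q ∷ r ∷ [])))
        where
        ρ : Fin 1 ⊎ Fin 2 ⊎ Fin 0 → Carrier A
        ρ = [ (λ _ → y) , [ pair x z , (λ ()) ] ]
      complete : ∀ k → Π ⊨[ V ] bound k
      complete k A A∈V ρ ps = ⊨ₑ-rename⁻ A ρ′ inj₁ (bound k)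
        (Equivalence.to (interpolates 0 (renameEq inj₁ (bound k))) consequence A A∈V ρ′
          (All.map⁺ (All.map (λ {ε} → ⊨ₑ-rename A ρ′ inj₁ ε) ps)))
        where
        ρ′ : Fin 2 ⊎ Fin 0 → Carrier A
        ρ′ = [ ρ , (λ ()) ]
        consequence : _ ⊨[ V ] renameEq inj₂ (renameEq inj₁ (bound k))
        consequence B B∈V σ (p ∷ q ∷ r ∷ []) =
          ⊨ₑ-rename B σ inj₂ (renameEq inj₁ (bound k)) (⊨ₑ-rename B (σ ∘ inj₂) inj₁ (bound k)
            (⊨ₑ-cong B (pair-η B (σ ∘ inj₂ ∘ inj₁)) (bound k) (Solution⇒⊨bound B∈V (p , q , r) k)))

    -- Failure of coherence

    module _ (coherent : Coherent V) where

      private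
        Γ : List (Equation (Fin 3))
        Γ = system (var zero) (var (1+ᶠ zero)) (var (1+ᶠ (1+ᶠ zero)))

        Cg-isEquivalence : IsEquivalence (Cg (Free V (Fin 3)) Γ)
        Cg-isEquivalence = Algebra.isEquivalence (quotient (Free V (Fin 3)) Γ)

        A : Algebra ℓ ℓ
        A = Quotient (Cg (Free V (Fin 3)) Γ) Cg-isEquivalence (λ o → cong o)

        A∈V : A ∈ V
        A∈V = Quotient∈V _ Cg-isEquivalence (λ o → cong o) incl

        A-finitelyPresented : FinitelyPresented V A
        A-finitelyPresented = 3 , Γ , record
          { ⟦_⟧ = lower ; ⟦⟧-cong = unshrink ; op-homo = λ o s t → incl (λ B _ _ → Algebra.≈-refl B)
          ; e-homo = incl (λ B _ _ → Algebra.≈-refl B) } ,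
          shrink , λ t → lift t , unshrink

        universal : ∀ {B} → B ∈ V → ∀ {x y z} → Solution B x y z → Hom A B
        universal {B} B∈V {x} {y} {z} (p , q , r) = record
          { ⟦_⟧     = λ t → eval B ρ (lower t)
          ; ⟦⟧-cong = λ s~t → Cg-sound B∈V ρ (p ∷ q ∷ r ∷ []) (unshrink s~t)
          ; op-homo = λ o s t → Algebra.≈-refl B
          ; e-homo  = Algebra.≈-refl B
          }
          where
          ρ : Fin 3 → Carrier B
          ρ zero                = x
          ρ (1+ᶠ zero)          = y
          ρ (1+ᶠ (1+ᶠ zero))    = z

        x y z : Carrier A
        x = lift (var zero)
        y = lift (var (1+ᶠ zero))
        z = lift (var (1+ᶠ (1+ᶠ zero)))

        solution : Solution A x y z
        solution = shrink (base (here ≡.refl)) , shrink (base (there (here ≡.refl))) ,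
          shrink (base (there (there (here ≡.refl))))

        S : Algebra ℓ ℓ
        S = subalgebra A (⟨_⟩ A (pair x z))

        xz : Fin 2 → Carrier S
        xz j = pair x z j , gen j

        S-finitelyPresented : FinitelyPresented V S
        S-finitelyPresented = coherent A A∈V A-finitelyPresented 2 (pair x z)

        n = proj₁ S-finitelyPresented
        R = proj₁ (proj₂ S-finitelyPresented)
        φ = proj₁ (proj₂ (proj₂ S-finitelyPresented))
        φ-injective = proj₁ (proj₂ (proj₂ (proj₂ S-finitelyPresented)))
        φ-surjective = proj₂ (proj₂ (proj₂ (proj₂ S-finitelyPresented)))
        S′ : Algebra _ _
        S′ = quotient (Free V (Fin n)) R

        -- p and w translate between the generators x, z of S and those of
        -- its finite presentation.
        p : Fin 2 → Term (Fin n)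
        p j = Hom.⟦ φ ⟧ (xz j)

        preimage : ∀ i → ∃[ t ] Cg (Free V (Fin n)) R (Hom.⟦ φ ⟧ (eval S xz t)) (var i)
        preimage i with φ-surjective (var i)
        ... | (u , u∈) , φu≈ with Generated-eval A (pair x z) u∈
        ... | t , t≈u = t , φu≈ (Algebra.≈-trans A (eval-hom (proj₁ (inclusion A (⟨_⟩ A (pair x z)))) xz t) t≈u)

        w : Fin n → Term (Fin 2)
        w i = proj₁ (preimage i)

        φ-w : ∀ t → Cg (Free V (Fin n)) R (Hom.⟦ φ ⟧ (eval S xz (subst w t))) t
        φ-w t = ≡.subst (Cg (Free V (Fin n)) R _) (≡.trans (quotient-eval V R var t) (subst-var t))
          (trans (Hom.⟦⟧-cong φ (reflexive S (eval-subst S xz w t)))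
          (trans (eval-hom φ (eval S xz ∘ w) t)
                 (eval-cong S′ (λ i → proj₂ (preimage i)) t)))

        generator : Fin 2 → Equation (Fin 2)
        generator j = var j , subst w (p j)

        relation : Equation (Fin n) → Equation (Fin 2)
        relation (s , t) = subst w s , subst w t

        -- A Tietze transformation: the presentation of `S` on `n` generators is rewritten for the
        -- generators x and z. Each old generator is replaced by its expression `w`, and the
        -- equations `generator` say that translating x and z there and back changes nothing.
        Π : List (Equation (Fin 2))
        Π = generator zero ∷ generator (1+ᶠ zero) ∷ map relation R

        S⊨p : ∀ j → S , xz ⊨ₑ generator j
        S⊨p j = φ-injective (sym (φ-w (p j)))

        S⊨R : ∀ ε → ε ∈ₗ R → S , xz ⊨ₑ relation ε
        S⊨R (s , t) m = φ-injective (trans (φ-w s) (trans (base m) (sym (φ-w t))))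

        -- Any solution in `B` induces a homomorphism from `A`, and its restriction to `S` carries
        -- equations between x and z along.
        transfer : ∀ {B} → B ∈ V → ∀ {x y z} → Solution B x y z → ∀ ε → S , xz ⊨ₑ ε → B , pair x z ⊨ₑ ε
        transfer {B} B∈V sol ε q = ⊨ₑ-cong B (λ { zero → Algebra.≈-refl B ; (1+ᶠ zero) → Algebra.≈-refl B }) ε
          (⊨ₑ-hom (universal B∈V sol ∘ₕ proj₁ (inclusion A (⟨_⟩ A (pair x z)))) xz ε q)

        sound : ∀ {B} → B ∈ V → ∀ {x y z} → Solution B x y z → All (B , pair x z ⊨ₑ_) Π
        sound B∈V sol =
          transfer B∈V sol (generator zero) (S⊨p zero) ∷
          transfer B∈V sol (generator (1+ᶠ zero)) (S⊨p (1+ᶠ zero)) ∷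
          All.map⁺ (All.tabulate λ {ε} m → transfer B∈V sol (relation ε) (S⊨R ε m))

        S⊨bound : ∀ k → S , xz ⊨ₑ bound k
        S⊨bound k = ⊨ₑ-embedding (inclusion A (⟨_⟩ A (pair x z))) xz (bound k)
          (⊨ₑ-cong A (λ { zero → Algebra.≈-refl A ; (1+ᶠ zero) → Algebra.≈-refl A }) (bound k)
            (Solution⇒⊨bound A∈V solution k))

        S′⊨ : ∀ s t → S , xz ⊨ₑ (s , t) → Cg (Free V (Fin n)) R (subst p s) (subst p t)
        S′⊨ s t q = ≡.subst₂ (Cg (Free V (Fin n)) R) (quotient-eval V R p s) (quotient-eval V R p t)
          (⊨ₑ-hom φ xz (s , t) q)

        complete : ∀ k → Π ⊨[ V ] bound k
        -- The valuation `σ` gives the old generators the values of their expressions in x and z. It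
        -- satisfies `R`, hence also the translation by `p` of every equation true in `S`; the two
        -- equations `generator` turn the values of `p` under `σ` back into `ρ`.
        complete k B B∈V ρ (q₀ ∷ q₁ ∷ qs) = ⊨ₑ-cong B {ρ = eval B σ ∘ p} {σ = ρ} σp≈ρ (bound k)
          (⊨ₑ-subst⁻ B σ p s t (Cg-sound B∈V σ
            (All.map (λ {ε} → ⊨ₑ-subst⁻ B ρ w (proj₁ ε) (proj₂ ε)) (All.map⁻ qs)) (S′⊨ s t (S⊨bound k))))
          where
          s = proj₁ (bound k)
          t = proj₂ (bound k)
          σ : Fin n → Carrier B
          σ = eval B ρ ∘ w
          back : ∀ j → B , ρ ⊨ₑ generator j → Algebra._≈_ B (eval B σ (p j)) (ρ j)
          back j q = Algebra.≈-sym B (≡.subst (Algebra._≈_ B (ρ j)) (eval-subst B ρ w (p j)) q)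
          σp≈ρ : ∀ j → Algebra._≈_ B (eval B σ (p j)) (ρ j)
          σp≈ρ zero       = back zero q₀
          σp≈ρ (1+ᶠ zero) = back (1+ᶠ zero) q₁

      incoherent : ⊥
      incoherent = no-finite-axiomatisation Π sound complete

-- Countability of the syntax

-- Common codes for all syntax. The decoders are total, and every number, formula and name has a
-- code, so an enumeration of the trees enumerates these as well.
data Tree : Set where
  leaf : Tree
  node : Tree → Tree → Tree

-- Cantor's walk: along each antidiagonal from `(s , 0)` to `(0 , s)`, then on to the start of the
-- next one.
next : ℕ × ℕ → ℕ × ℕ
next (zero , b) = 1+ b , 0
next (1+ a , b) = a , 1+ b

unpair : ℕ → ℕ × ℕ
unpair zero   = 0 , 0
unpair (1+ n) = next (unpair n)

-- s is the index of the antidiagonal containing (a , b).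
unpair-on-diagonal : ∀ s a b → a + b ≡ s → ∃[ n ] unpair n ≡ (a , b)
unpair-on-diagonal s      zero   zero   _ = 0 , ≡.refl
unpair-on-diagonal (1+ s) (1+ a) zero   q
  with unpair-on-diagonal s zero a (≡.trans (≡.sym (ℕ.+-identityʳ a)) (ℕ.suc-injective q))
... | n , p = 1+ n , ≡.cong next p
unpair-on-diagonal s      a      (1+ b) q
  with unpair-on-diagonal s (1+ a) b (≡.trans (≡.sym (ℕ.+-suc a b)) q)
... | n , p = 1+ n , ≡.cong next p

unpair-surjective : ∀ a b → ∃[ n ] unpair n ≡ (a , b)
unpair-surjective a b = unpair-on-diagonal (a + b) a b ≡.refl

-- The depth is fuel, as the components of `unpair n` are not structurally smaller than `1+ n`.
treeOfDepth : ℕ → ℕ → Tree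
treeOfDepth zero   n      = leaf
treeOfDepth (1+ d) zero   = leaf
treeOfDepth (1+ d) (1+ n) = node (treeOfDepth d (proj₁ (unpair n))) (treeOfDepth d (proj₂ (unpair n)))

-- Covering all larger depths lets two subtrees of different depths be decoded with a common one.
treeOfDepth-surjective : ∀ t → ∃[ n ] ∃[ d ] ∀ d′ → d ≤ d′ → treeOfDepth d′ n ≡ t
treeOfDepth-surjective leaf = 0 , 0 , λ { zero _ → ≡.refl ; (1+ _) _ → ≡.refl }
treeOfDepth-surjective (node s t) with treeOfDepth-surjective s | treeOfDepth-surjective t
... | m , d₁ , p | n , d₂ , q with unpair-surjective m n
... | k , r = 1+ k , 1+ (d₁ ⊔ⁿ d₂) , λ { (1+ d) (s≤s d≥) → ≡.cong₂ node
  (≡.trans (≡.cong (treeOfDepth d ∘ proj₁) r) (p d (ℕ.≤-trans (ℕ.m≤m⊔n d₁ d₂) d≥)))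
  (≡.trans (≡.cong (treeOfDepth d ∘ proj₂) r) (q d (ℕ.≤-trans (ℕ.m≤n⊔m d₁ d₂) d≥))) }

tree : ℕ → Tree
tree n = treeOfDepth (proj₁ (unpair n)) (proj₂ (unpair n))

tree-surjective : ∀ t → ∃[ n ] tree n ≡ t
tree-surjective t with treeOfDepth-surjective t
... | k , d , p with unpair-surjective d k
... | n , q = n , ≡.trans (≡.cong (λ (d , k) → treeOfDepth d k) q) (p d ℕ.≤-refl)

-- A name denotes an element of every structure: skolem φ ρ denotes a
-- counterexample to ∀̇ φ at the elements denoted by ρ.
data Name : Set where
  generator : ℕ → Name
  one       : Name
  apply     : BinOp → Name → Name → Name
  skolem    : ∀ {n} → Formula ⊥ (1+ n) → Vec Name n → Name

decodeℕ : Tree → ℕ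
decodeℕ leaf       = 0
decodeℕ (node _ t) = 1+ (decodeℕ t)

decodeFin : ∀ n → Tree → Fin (1+ n)
decodeFin zero   _          = zero
decodeFin (1+ n) leaf       = zero
decodeFin (1+ n) (node _ t) = 1+ᶠ (decodeFin n t)

decodeOp : Tree → BinOp
decodeOp leaf                            = meet
decodeOp (node _ leaf)                   = join
decodeOp (node _ (node _ leaf))          = mult
decodeOp (node _ (node leaf (node _ _))) = under
decodeOp (node _ (node (node _ _) (node _ _)))  = over

decodeVar : ∀ n → Tree → Term (⊥ ⊎ Fin n)
decodeVar zero   _ = e
decodeVar (1+ n) t = var (inj₂ (decodeFin n t))

decodeTerm : ∀ n → Tree → Term (⊥ ⊎ Fin n)
decodeTerm n leaf                = e
decodeTerm n (node leaf t)       = decodeVar n t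
decodeTerm n (node (node o s) t) = op (decodeOp o) (decodeTerm n s) (decodeTerm n t)

decodeFormula : ∀ n → Tree → Formula ⊥ n
decodeFormula n leaf                         = ⊥̇
decodeFormula n (node leaf t)                = ∀̇ decodeFormula (1+ n) t
decodeFormula n (node (node leaf s) t)       = decodeTerm n s ≐ decodeTerm n t
decodeFormula n (node (node (node _ _) s) t) = decodeFormula n s ⇒̇ decodeFormula n t

decodeName  : Tree → Name
decodeNames : ∀ n → Tree → Vec Name n
decodeName leaf                                = one
decodeName (node leaf t)                       = generator (decodeℕ t)
-- The tree `s` codes the vector and, by the length of its right spine, the size of the vector; the
-- formula has one more variable, for the counterexample.
decodeName (node (node leaf t) s)              =
  skolem (decodeFormula (1+ (decodeℕ s)) t) (decodeNames (decodeℕ s) s)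
decodeName (node (node (node o _) s) t)        = apply (decodeOp o) (decodeName s) (decodeName t)
decodeNames zero   _          = []
decodeNames (1+ n) leaf       = one ∷ decodeNames n leaf
decodeNames (1+ n) (node s t) = decodeName s ∷ decodeNames n t

encodeℕ : ∀ n → ∃[ t ] decodeℕ t ≡ n
encodeℕ zero   = leaf , ≡.refl
encodeℕ (1+ n) with encodeℕ n
... | t , p = node leaf t , ≡.cong 1+ p

encodeFin : ∀ {n} (i : Fin (1+ n)) → ∃[ t ] decodeFin n t ≡ i
encodeFin {zero}  zero     = leaf , ≡.refl
encodeFin {1+ n}  zero     = leaf , ≡.refl
encodeFin {1+ n}  (1+ᶠ i) with encodeFin i
... | t , p = node leaf t , ≡.cong 1+ᶠ p

encodeOp : ∀ o → ∃[ t ] decodeOp t ≡ o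
encodeOp meet  = leaf , ≡.refl
encodeOp join  = node leaf leaf , ≡.refl
encodeOp mult  = node leaf (node leaf leaf) , ≡.refl
encodeOp under = node leaf (node leaf (node leaf leaf)) , ≡.refl
encodeOp over  = node leaf (node (node leaf leaf) (node leaf leaf)) , ≡.refl

encodeTerm : ∀ {n} (t : Term (⊥ ⊎ Fin n)) → ∃[ c ] decodeTerm n c ≡ t
encodeTerm {zero} (var (inj₂ ()))
encodeTerm {1+ n} (var (inj₂ i)) with encodeFin i
... | c , p = node leaf c , ≡.cong (var ∘ inj₂) p
encodeTerm e = leaf , ≡.refl
encodeTerm (op o s t) with encodeOp o | encodeTerm s | encodeTerm t
... | a , ≡.refl | b , ≡.refl | c , ≡.refl = node (node a b) c , ≡.refl

encodeFormula : ∀ {n} (φ : Formula ⊥ n) → ∃[ c ] decodeFormula n c ≡ φ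
encodeFormula (s ≐ t) with encodeTerm s | encodeTerm t
... | b , ≡.refl | c , ≡.refl = node (node leaf b) c , ≡.refl
encodeFormula ⊥̇ = leaf , ≡.refl
encodeFormula (φ ⇒̇ ψ) with encodeFormula φ | encodeFormula ψ
... | b , ≡.refl | c , ≡.refl = node (node (node leaf leaf) b) c , ≡.refl
encodeFormula (∀̇ φ) with encodeFormula φ
... | c , ≡.refl = node leaf c , ≡.refl

encodeName  : ∀ u → ∃[ c ] decodeName c ≡ u
encodeNames : ∀ {n} (us : Vec Name n) → ∃[ c ] (decodeℕ c ≡ n × decodeNames n c ≡ us)
encodeName (generator n) with encodeℕ n
... | c , ≡.refl = node leaf c , ≡.refl
encodeName one = leaf , ≡.refl
encodeName (apply o s t) with encodeOp o | encodeName s | encodeName t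
... | a , ≡.refl | b , ≡.refl | c , ≡.refl = node (node (node a leaf) b) c , ≡.refl
encodeName (skolem φ us) with encodeNames us
... | c , ≡.refl , ≡.refl with encodeFormula φ
... | b , ≡.refl = node (node leaf b) c , ≡.refl
encodeNames []       = leaf , ≡.refl , ≡.refl
encodeNames (u ∷ us) with encodeName u | encodeNames us
... | b , ≡.refl | c , ≡.refl , ≡.refl = node b c , ≡.refl , ≡.refl

Instance : Set
Instance = Σ[ n ∈ ℕ ] Formula ⊥ n × Vec Name n

decodeInstance : Tree → Instance
decodeInstance leaf       = 0 , ⊥̇ , []
decodeInstance (node s t) = decodeℕ t , decodeFormula (decodeℕ t) s , decodeNames (decodeℕ t) t

instances : ℕ → Instance
instances = decodeInstance ∘ tree

instances-surjective : ∀ i → ∃[ k ] instances k ≡ i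
instances-surjective (n , φ , us) with encodeNames us
... | c , ≡.refl , ≡.refl with encodeFormula φ
... | b , ≡.refl with tree-surjective (node b c)
... | k , p = k , ≡.cong decodeInstance p

-- Filters deciding countably many sets

module GenericFilter {ℓ : Level} (em : ExcludedMiddle ℓ) (P : ℕ → Pred ℕ ℓ) where

  Infinite : Pred ℕ ℓ → Set ℓ
  Infinite I = ∀ m → ∃[ i ] m ≤ i × i ∈ I

  -- One of the two parts into which `P n` splits the infinite set `I` is infinite. Indices below
  -- `n` are dropped as well, which makes every final segment large.
  refine : ∀ n (I : Pred ℕ ℓ) → Infinite I →
           Σ[ J ∈ Pred ℕ ℓ ] Infinite J × J ⊆ I × (∀ {i} → i ∈ J → n ≤ i) × (J ⊆ P n ⊎ J ⊆ ∁ (P n))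
  refine n I inf with em {Infinite (λ i → n ≤ i × i ∈ I × i ∈ P n)}
  ... | yes p = _ , p , proj₁ ∘ proj₂ , proj₁ , inj₁ (proj₂ ∘ proj₂)
  ... | no ¬p = (λ i → n ≤ i × i ∈ I × i ∈ ∁ (P n)) , rest-infinite , proj₁ ∘ proj₂ , proj₁ , inj₂ (proj₂ ∘ proj₂)
    where
    -- If the part outside `P n` had no member from `m` on, all later members of `I` would lie in
    -- `P n`, and the part inside would be infinite.
    rest-infinite : Infinite (λ i → n ≤ i × i ∈ I × i ∈ ∁ (P n))
    rest-infinite m with em {∃[ i ] m ≤ i × n ≤ i × i ∈ I × i ∈ ∁ (P n)}
    ... | yes q = q
    ... | no ¬q = ⊥-elim (¬p λ k →
      let i , k≤i , i∈I = inf (k ⊔ⁿ (m ⊔ⁿ n))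
          m⊔n≤i = ℕ.≤-trans (ℕ.m≤n⊔m k _) k≤i
          n≤i = ℕ.≤-trans (ℕ.m≤n⊔m m n) m⊔n≤i
      in i , ℕ.≤-trans (ℕ.m≤m⊔n k _) k≤i , n≤i , i∈I , i∈P i (ℕ.≤-trans (ℕ.m≤m⊔n m n) m⊔n≤i) n≤i i∈I)
      where
      i∈P : ∀ i → m ≤ i → n ≤ i → i ∈ I → i ∈ P n
      i∈P i m≤i n≤i i∈I with em {P n i}
      ... | yes r = r
      ... | no ¬r = ⊥-elim (¬q (i , m≤i , n≤i , i∈I , ¬r))

  stage : ℕ → Σ[ I ∈ Pred ℕ ℓ ] Infinite I
  stage zero   = (λ _ → Lift ℓ (0 ≤ 0)) , λ m → m , ℕ.≤-refl , lift z≤n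
  stage (1+ n) = let J , inf , _ = refine n (proj₁ (stage n)) (proj₂ (stage n)) in J , inf

  stage-anti : ∀ {m n} → m ≤′ n → proj₁ (stage n) ⊆ proj₁ (stage m)
  stage-anti ≤′-refl i∈ = i∈
  stage-anti {n = 1+ n} (≤′-step q) i∈ =
    stage-anti q (proj₁ (proj₂ (proj₂ (refine n (proj₁ (stage n)) (proj₂ (stage n))))) i∈)

  -- The filter generated by the decreasing sequence of stages. It is proper because each stage is
  -- infinite.
  Large : Pred ℕ ℓ → Set ℓ
  Large Q = ∃[ n ] proj₁ (stage n) ⊆ Q

  large-mono : ∀ {Q R} → Q ⊆ R → Large Q → Large R
  large-mono q (n , p) = n , λ i∈ → q (p i∈)

  large-∩ : ∀ {Q R} → Large Q → Large R → Large (Q ∩ R)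
  large-∩ (m , p) (n , q) = m ⊔ⁿ n , λ i∈ →
    p (stage-anti (ℕ.≤⇒≤′ (ℕ.m≤m⊔n m n)) i∈) , q (stage-anti (ℕ.≤⇒≤′ (ℕ.m≤n⊔m m n)) i∈)

  -- Stage `1+ m`, the result of `refine m`, has no member below `m`.
  large-eventually : ∀ {Q} m → (∀ {i} → m ≤ i → i ∈ Q) → Large Q
  large-eventually m q = 1+ m , λ i∈ →
    q (proj₁ (proj₂ (proj₂ (proj₂ (refine m (proj₁ (stage m)) (proj₂ (stage m)))))) i∈)

  large-satisfiable : ∀ {Q} → Large Q → ∃[ i ] i ∈ Q
  large-satisfiable (n , p) = let i , _ , i∈ = proj₂ (stage n) 0 in i , p i∈

  large-decides : ∀ n → Large (P n) ⊎ Large (∁ (P n))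
  large-decides n with proj₂ (proj₂ (proj₂ (proj₂ (refine n (proj₁ (stage n)) (proj₂ (stage n))))))
  ... | inj₁ p = inj₁ (1+ n , p)
  ... | inj₂ p = inj₂ (1+ n , p)

-- Ultraproducts restricted to the elements with a name, so that only countably
-- many index sets have to be decided: an ultrafilter on all sets of natural
-- numbers would need a choice function respecting extensional equality.

module Ultraproduct {ℓ : Level} (em : ExcludedMiddle ℓ) (K : ℕ → Algebra ℓ ℓ) (g : ∀ i → ℕ → Carrier (K i)) where

  -- A Skolem function for the negation of `∀̇ φ`. The default `e` is taken only if no
  -- counterexample exists, and then any element will do.
  counterexample : ∀ (A : Algebra ℓ ℓ) {n} → Formula ⊥ (1+ n) → Vec (Carrier A) n → Carrier A
  counterexample A φ ρ with em {∃[ u ] ¬ Sat A ⊥-elim (u ∷ ρ) φ}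
  ... | yes (u , _) = u
  ... | no _        = Algebra.e A

  counterexample-correct : ∀ (A : Algebra ℓ ℓ) {n} (φ : Formula ⊥ (1+ n)) ρ →
    Sat A ⊥-elim (counterexample A φ ρ ∷ ρ) φ → Sat A ⊥-elim ρ (∀̇ φ)
  counterexample-correct A φ ρ p u with em {∃[ u ] ¬ Sat A ⊥-elim (u ∷ ρ) φ}
  ... | yes (_ , ¬p) = ⊥-elim (¬p p)
  ... | no ¬ex with em {Sat A ⊥-elim (u ∷ ρ) φ}
  ...   | yes q = q
  ...   | no ¬q = ⊥-elim (¬ex (u , ¬q))

  module _ (i : ℕ) where

    ⟦_⟧  : Name → Carrier (K i)
    ⟦_⟧* : ∀ {n} → Vec Name n → Vec (Carrier (K i)) n
    ⟦ generator k ⟧ = g i k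
    ⟦ one ⟧         = Algebra.e (K i)
    ⟦ apply o s t ⟧ = Algebra.op (K i) o ⟦ s ⟧ ⟦ t ⟧
    ⟦ skolem φ us ⟧ = counterexample (K i) φ ⟦ us ⟧*
    ⟦ [] ⟧*     = []
    ⟦ u ∷ us ⟧* = ⟦ u ⟧ ∷ ⟦ us ⟧*

  Holds : ∀ {n} → Formula ⊥ n → Vec Name n → Pred ℕ ℓ
  Holds φ us i = Sat (K i) ⊥-elim (⟦ i ⟧* us) φ

  HoldsInstance : ℕ → Pred ℕ ℓ
  HoldsInstance k = Holds (proj₁ (proj₂ (instances k))) (proj₂ (proj₂ (instances k)))

  open GenericFilter em HoldsInstance public

  decides : ∀ {n} (φ : Formula ⊥ n) us → Large (Holds φ us) ⊎ Large (∁ (Holds φ us))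
  decides φ us with instances-surjective (_ , φ , us)
  ... | k , p = ≡.subst (λ (_ , φ , us) → Large (Holds φ us) ⊎ Large (∁ (Holds φ us))) p (large-decides k)

  limit : Algebra ℓ ℓ
  limit = record
    { Carrier       = Lift ℓ Name
    ; _≈_           = λ s t → Large (λ i → Algebra._≈_ (K i) (⟦ i ⟧ (lower s)) (⟦ i ⟧ (lower t)))
    ; isEquivalence = record
      { refl  = large-eventually 0 (λ {i} _ → Algebra.≈-refl (K i))
      ; sym   = large-mono (λ {i} → Algebra.≈-sym (K i))
      ; trans = λ p q → large-mono (λ {i} (p , q) → Algebra.≈-trans (K i) p q) (large-∩ p q)
      }
    ; op            = λ o s t → lift (apply o (lower s) (lower t))
    ; e             = lift one
    ; op-cong       = λ o p q → large-mono (λ {i} (p , q) → Algebra.op-cong (K i) o p q) (large-∩ p q)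
    }

  eval-limit : ∀ i {a} {X : Set a} (ρ : X → Carrier limit) t →
               ⟦ i ⟧ (lower (eval limit ρ t)) ≡ eval (K i) (⟦ i ⟧ ∘ lower ∘ ρ) t
  eval-limit i ρ (var v)    = ≡.refl
  eval-limit i ρ e          = ≡.refl
  eval-limit i ρ (op o s t) = ≡.cong₂ (Algebra.op (K i) o) (eval-limit i ρ s) (eval-limit i ρ t)

  ⊨ₑ-limit : ∀ {a} {X : Set a} (ρ : X → Carrier limit) ε →
             (Large (λ i → K i , ⟦ i ⟧ ∘ lower ∘ ρ ⊨ₑ ε) → limit , ρ ⊨ₑ ε) ×
             (limit , ρ ⊨ₑ ε → Large (λ i → K i , ⟦ i ⟧ ∘ lower ∘ ρ ⊨ₑ ε))
  ⊨ₑ-limit ρ (s , t) =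
    large-mono (λ {i} → ≡.subst₂ (Algebra._≈_ (K i)) (≡.sym (eval-limit i ρ s)) (≡.sym (eval-limit i ρ t))) ,
    large-mono (λ {i} → ≡.subst₂ (Algebra._≈_ (K i)) (eval-limit i ρ s) (eval-limit i ρ t))

  names : ∀ {n} → Vec Name n → Vec (Carrier limit) n
  names []       = []
  names (u ∷ us) = lift u ∷ names us

  assignment : ∀ i {n} (us : Vec Name n) (v : ⊥ ⊎ Fin n) →
               ⟦ i ⟧ (lower ([ ⊥-elim , lookup (names us) ] v)) ≡ [ ⊥-elim , lookup (⟦ i ⟧* us) ] v
  assignment i (u ∷ us) (inj₂ zero)     = ≡.refl
  assignment i (u ∷ us) (inj₂ (1+ᶠ j)) = assignment i us (inj₂ j)

  -- Falsity uses that large sets are nonempty, implication that the filter decides where the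
  -- premise holds, and the quantifier that the name `skolem φ us` denotes a counterexample in every
  -- factor that has one.
  łoś : ∀ {n} (φ : Formula ⊥ n) (us : Vec Name n) →
        (Large (Holds φ us) → Sat limit ⊥-elim (names us) φ) ×
        (Sat limit ⊥-elim (names us) φ → Large (Holds φ us))
  łoś (s ≐ t) us =
    (λ p → proj₁ (⊨ₑ-limit _ (s , t)) (large-mono (λ {i} →
      ⊨ₑ-cong (K i) (λ v → Algebra.≈-sym (K i) (reflexive (K i) (assignment i us v))) (s , t)) p)) ,
    (λ p → large-mono (λ {i} →
      ⊨ₑ-cong (K i) (λ v → reflexive (K i) (assignment i us v)) (s , t)) (proj₂ (⊨ₑ-limit _ (s , t)) p))
  łoś ⊥̇ us = (λ p → proj₂ (large-satisfiable p)) , λ p → ⊥-elim (lower p)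
  łoś (φ ⇒̇ ψ) us =
    (λ p q → proj₁ (łoś ψ us) (large-mono (λ (r , s) → r s) (large-∩ p (proj₂ (łoś φ us) q)))) ,
    λ p → implication p (decides φ us)
    where
    implication : (Sat limit ⊥-elim (names us) φ → Sat limit ⊥-elim (names us) ψ) →
                  Large (Holds φ us) ⊎ Large (∁ (Holds φ us)) → Large (Holds (φ ⇒̇ ψ) us)
    implication p (inj₁ q)  = large-mono const (proj₂ (łoś ψ us) (p (proj₁ (łoś φ us) q)))
    implication p (inj₂ ¬q) = large-mono (λ ¬r r → ⊥-elim (¬r r)) ¬q
  łoś (∀̇ φ) us =
    (λ p u → proj₁ (łoś φ (lower u ∷ us)) (large-mono (λ q → q _) p)) ,
    λ p → large-mono (λ {i} → counterexample-correct (K i) φ (⟦ i ⟧* us))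
            (proj₂ (łoś φ (skolem φ us ∷ us)) (p (lift (skolem φ us))))

  limit-model : {τ : Level} (T : PureTheory τ) → (∀ i → K i ⊨ᵀ T) → limit ⊨ᵀ T
  limit-model T K⊨T φ φ∈T = proj₁ (łoś φ []) (large-eventually 0 λ {i} _ → K⊨T i φ φ∈T)

-- Formulas

module _ (A : Algebra ℓ ℓ) {P : Set a} {Q : Set b} {f : P → Q} {γ : Q → Carrier A} {δ : P → Carrier A}
         (γf≡δ : ∀ v → γ (f v) ≡ δ v) where

  private
    extended : ∀ {n} (ρ : Vec (Carrier A) n) v → Algebra._≈_ A ([ γ , lookup ρ ] (Sum.map₁ f v)) ([ δ , lookup ρ ] v)
    extended ρ (inj₁ v) = reflexive A (γf≡δ v)
    extended ρ (inj₂ j) = Algebra.≈-refl A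

  Sat-mapConst  : ∀ {n} (ρ : Vec (Carrier A) n) φ → Sat A δ ρ φ → Sat A γ ρ (mapConst f φ)
  Sat-mapConst⁻ : ∀ {n} (ρ : Vec (Carrier A) n) φ → Sat A γ ρ (mapConst f φ) → Sat A δ ρ φ
  Sat-mapConst ρ (s ≐ t) p = ⊨ₑ-rename A [ γ , lookup ρ ] (Sum.map₁ f) (s , t)
    (⊨ₑ-cong A (λ v → Algebra.≈-sym A (extended ρ v)) (s , t) p)
  Sat-mapConst ρ ⊥̇       p = p
  Sat-mapConst ρ (φ ⇒̇ ψ) p q = Sat-mapConst ρ ψ (p (Sat-mapConst⁻ ρ φ q))
  Sat-mapConst ρ (∀̇ φ)   p u = Sat-mapConst (u ∷ ρ) φ (p u)
  Sat-mapConst⁻ ρ (s ≐ t) p = ⊨ₑ-cong A (extended ρ) (s , t)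
    (⊨ₑ-rename⁻ A [ γ , lookup ρ ] (Sum.map₁ f) (s , t) p)
  Sat-mapConst⁻ ρ ⊥̇       p = p
  Sat-mapConst⁻ ρ (φ ⇒̇ ψ) p q = Sat-mapConst⁻ ρ ψ (p (Sat-mapConst ρ φ q))
  Sat-mapConst⁻ ρ (∀̇ φ)   p u = Sat-mapConst⁻ (u ∷ ρ) φ (p u)

module _ {M A : Algebra ℓ ℓ} (h : Embedding M A) where

  private
    γ : Carrier M → Carrier A
    γ = Hom.⟦ proj₁ h ⟧

    image-assignment : ∀ (v : Carrier M ⊎ Fin 0) → γ ([ id , lookup [] ] v) ≡ [ γ , lookup [] ] v
    image-assignment (inj₁ v) = ≡.refl

  -- Both directions are proved together, because an implication reverses the direction in its
  -- premise.
  Sat-quantifierFree : ∀ (φ : Sentence (Carrier M)) → QuantifierFree φ →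
                       (Sat M id [] φ → Sat A γ [] φ) × (Sat A γ [] φ → Sat M id [] φ)
  Sat-quantifierFree (s ≐ t) _ =
    (λ p → ⊨ₑ-cong A (λ v → reflexive A (image-assignment v)) (s , t) (⊨ₑ-hom (proj₁ h) _ (s , t) p)) ,
    (λ p → ⊨ₑ-embedding h _ (s , t) (⊨ₑ-cong A (λ v → reflexive A (≡.sym (image-assignment v))) (s , t) p))
  Sat-quantifierFree ⊥̇ _ = (λ p → lift (lower p)) , (λ p → lift (lower p))
  Sat-quantifierFree (φ ⇒̇ ψ) (qφ , qψ) =
    (λ p q → proj₁ (Sat-quantifierFree ψ qψ) (p (proj₂ (Sat-quantifierFree φ qφ) q))) ,
    (λ p q → proj₂ (Sat-quantifierFree ψ qψ) (p (proj₁ (Sat-quantifierFree φ qφ) q)))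

  diagram-model : (T : PureTheory τ) → A ⊨ᵀ T → IsModel (expand (Carrier M) T ∪ diagram M) A γ
  diagram-model T A⊨T _ (inj₁ (ψ , ψ∈T , ≡.refl)) = Sat-mapConst A (λ ()) [] ψ (A⊨T ψ ψ∈T)
  diagram-model T A⊨T φ (inj₂ (qf , p)) = proj₁ (Sat-quantifierFree φ qf) p

infixr 4 _⇛_
_⇛_ : {P : Set a} {n : ℕ} → List (Equation (P ⊎ Fin n)) → Formula P n → Formula P n
Γ ⇛ φ = foldr (λ (s , t) ψ → (s ≐ t) ⇒̇ ψ) φ Γ

-- Failure of model completion

module NoModelCompletion {ℓ κ : Level} (em : ExcludedMiddle (suc ℓ ⊔ κ)) (C : Class ℓ κ)
            (variety : IsVariety (ISP C)) (V⊆RL : ISP C ⊆ IsResiduatedLattice)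
            (canonical : ClosedUnderCanonicalExtensions C) where
  open Main em C variety V⊆RL canonical

  ∈V⇒⊨Th : ∀ {A} → A ∈ V → A ⊨ᵀ Th V
  ∈V⇒⊨Th A∈V φ φ∈Th = φ∈Th _ A∈V

  Solution⇒Bounded-sentence : ℕ → Sentence ⊥
  Solution⇒Bounded-sentence k = ∀̇ ∀̇ ∀̇ (system x y z ⇛ (z ≐ op meet z ((x ↓) ^ k)))
    where
    x y z : Term (⊥ ⊎ Fin 3)
    x = var (inj₂ zero)
    y = var (inj₂ (1+ᶠ zero))
    z = var (inj₂ (1+ᶠ (1+ᶠ zero)))

  -- A model of `Th V` is not known to belong to `V`, so the bound is passed on by a first-order
  -- sentence for each `k`.
  ⊨Th⇒Solution⇒Bounded : ∀ {A : Algebra ℓ ℓ} → A ⊨ᵀ Th V → ∀ {x y z} → Solution A x y z → ∀ k → Bounded A x z k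
  ⊨Th⇒Solution⇒Bounded {A} A⊨Th {x} {y} {z} (p , q , r) k =
    ≡.subst (λ d → _⊑_ A z d) (eval-^ A _ (var (inj₂ zero) ↓) k)
      -- The outermost quantifier binds the last variable, so the values come in the order z, y, x.
      (A⊨Th (Solution⇒Bounded-sentence k) valid z y x p q r)
    where
    valid : Solution⇒Bounded-sentence k ∈ Th V
    valid B B∈V w v u p q r = ≡.subst (λ d → _⊑_ B w d) (≡.sym (eval-^ B _ (var (inj₂ zero) ↓) k))
      (ResiduatedLattice.Solution⇒Bounded (V⊆RL B∈V) (p , q , r) k)

  module _ (unbounded : ∀ k → ¬ (k ⊢ bound (1+ k)))
           {T* : PureTheory (suc ℓ ⊔ κ)} (modelCompletion : IsModelCompletion ℓ (Th V) T*) where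

    private
      M : Algebra ℓ ℓ
      M = Limit.algebra

      extend : ∀ {A : Algebra ℓ ℓ} → A ⊨ᵀ Th V → Σ[ B ∈ Algebra ℓ ℓ ] B ⊨ᵀ T* × Embedding A B
      extend = proj₁ (proj₂ modelCompletion) _

      stage-extension : ∀ k → Σ[ B ∈ Algebra ℓ ℓ ] B ⊨ᵀ T* × Embedding (Stage.algebra k) B
      stage-extension k = extend (∈V⇒⊨Th (Stage.algebra∈V k))

      K : ℕ → Algebra ℓ ℓ
      K k = proj₁ (stage-extension k)

      K⊨T* : ∀ k → K k ⊨ᵀ T*
      K⊨T* k = proj₁ (proj₂ (stage-extension k))

      h : ∀ k → Embedding (Stage.algebra k) (K k)
      h k = proj₂ (proj₂ (stage-extension k))

      point : ∀ k → Fin 2 → Carrier (K k)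
      point k v = Hom.⟦ proj₁ (h k) ⟧ (lift (var v))

      K⊨⇔⊢ : ∀ k ε → (k ⊢ ε → K k , point k ⊨ₑ ε) × (K k , point k ⊨ₑ ε → k ⊢ ε)
      K⊨⇔⊢ k ε =
        (λ p → ⊨ₑ-hom (proj₁ (h k)) (lift ∘ var) ε (proj₁ (Stage.⊨⇔⊢ k ε) p)) ,
        (λ p → proj₂ (Stage.⊨⇔⊢ k ε) (⊨ₑ-embedding (h k) (lift ∘ var) ε p))

      -- The names `generator 0` and `generator 1` stand for x and z; all further ones repeat z.
      generators : ∀ k → ℕ → Carrier (K k)
      generators k zero   = point k zero
      generators k (1+ _) = point k (1+ᶠ zero)

      em-ℓ : ExcludedMiddle ℓ
      em-ℓ {P} = map′ lower lift (em {Lift (suc ℓ ⊔ κ) P})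

      open Ultraproduct em-ℓ K generators renaming (limit to L)

      xz : Fin 2 → Carrier L
      xz = pair (lift (generator 0)) (lift (generator 1))

      xz-point : ∀ k v → Algebra._≈_ (K k) (⟦_⟧ k (lower (xz v))) (point k v)
      xz-point k zero       = Algebra.≈-refl (K k)
      xz-point k (1+ᶠ zero) = Algebra.≈-refl (K k)

      -- A consequence of `bound k` is a consequence of every later bound, so it holds in all
      -- factors from index `k` on.
      M⇒L : ∀ ε → ∃[ k ] k ⊢ ε → L , xz ⊨ₑ ε
      M⇒L ε (k , p) = proj₁ (⊨ₑ-limit xz ε) (large-eventually k λ {i} k≤i →
        ⊨ₑ-cong (K i) (λ v → Algebra.≈-sym (K i) (xz-point i v)) ε (proj₁ (K⊨⇔⊢ i ε) (⊢-mono k≤i ε p)))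

      -- A single factor satisfying the equation is enough, because the embedding of the stage into
      -- it reflects equations.
      L⇒M : ∀ ε → L , xz ⊨ₑ ε → ∃[ k ] k ⊢ ε
      L⇒M ε p =
        let k , q = large-satisfiable (proj₂ (⊨ₑ-limit xz ε) p)
        in k , proj₂ (K⊨⇔⊢ k ε) (⊨ₑ-cong (K k) (xz-point k) ε q)

      M↪L : Embedding M L
      M↪L = record
        { ⟦_⟧     = λ t → eval L xz (lower t)
        ; ⟦⟧-cong = λ { {lift s} {lift t} p → M⇒L (s , t) (unshrink p) }
        ; op-homo = λ o s t → Algebra.≈-refl L {eval L xz (op o (lower s) (lower t))}
        ; e-homo  = Algebra.≈-refl L {lift one}
        } , λ { {lift s} {lift t} p → shrink (L⇒M (s , t) p) }

      K-unsolvable : ∀ k y → ¬ Solution (K k) (point k zero) y (point k (1+ᶠ zero))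
      K-unsolvable k y sol = unbounded k (proj₂ (K⊨⇔⊢ k (bound (1+ k))) (⊨bound (K k) (1+ k)
        (⊨Th⇒Solution⇒Bounded (λ φ φ∈Th → K⊨T* k φ (proj₁ modelCompletion φ∈Th)) sol (1+ k))))

      -- Each of the three inequalities would hold on a large set of indices; at a common index the
      -- element named by `y` would solve the system in that factor.
      L-unsolvable : ∀ y → ¬ Solution L (xz zero) y (xz (1+ᶠ zero))
      L-unsolvable y (p , q , r) =
        let k , sol = large-satisfiable (large-∩ p (large-∩ q r)) in K-unsolvable k (⟦_⟧ k (lower y)) sol

      -- The sentence left undecided: true in `L`, false in `solvable-extension`.
      unsolvable : Sentence (Carrier M)
      unsolvable = ∀̇ (system (var (inj₁ Limit.x)) (var (inj₂ zero)) (var (inj₁ Limit.z)) ⇛ ⊥̇)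

      solvable-extension : Σ[ B ∈ Algebra ℓ ℓ ] B ⊨ᵀ T* × Σ[ (f , _) ∈ Embedding M B ]
                           ∃[ y ] Solution B (Hom.⟦ f ⟧ Limit.x) y (Hom.⟦ f ⟧ Limit.z)
      solvable-extension =
        let A , A∈V , f , y , sol = Limit.extension
            B , B⊨T* , g = extend (∈V⇒⊨Th A∈V)
        in B , B⊨T* , g ∘ₑ f , Hom.⟦ proj₁ g ⟧ y , Solution-hom (proj₁ g) sol

      complete : IsCompleteTheory ℓ (expand (Carrier M) T* ∪ diagram M)
      complete = proj₂ (proj₂ modelCompletion) M (∈V⇒⊨Th Limit.algebra∈V)

      not-refuted : ¬ Entails ℓ (expand (Carrier M) T* ∪ diagram M) (¬̇ unsolvable)
      not-refuted refuted = lower (refuted L _ (diagram-model M↪L T* (limit-model T* K⊨T*))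
        λ y p q r → lift (L-unsolvable y (p , q , r)))

      not-entailed : ¬ Entails ℓ (expand (Carrier M) T* ∪ diagram M) unsolvable
      not-entailed entailed =
        let B , B⊨T* , f , y , p , q , r = solvable-extension
        in lower (entailed B _ (diagram-model f T* B⊨T*) y p q r)

    ¬modelCompletion : ⊥
    ¬modelCompletion = [ not-entailed , not-refuted ] (complete unsolvable)

corollary5p11 : ∀ {ℓ κ : Level} →
    ExcludedMiddle (suc ℓ ⊔ κ) →
    (C : Class ℓ κ) →
    let V   = ISP C
        e∧x = op meet e (var {X = ⊤} tt)
    in
    IsVariety V →
    V ⊆ IsResiduatedLattice →
    ClosedUnderCanonicalExtensions C →
    (∀ (n : ℕ) → ¬ (V ⊨ (e∧x ^ 1+ n , e∧x ^ n))) →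
    ¬ Coherent V × ¬ RightUniformDeductiveInterpolation V × ¬ HasModelCompletion ℓ (Th V)
corollary5p11 em C variety V⊆RL canonical noStabilisation =
  incoherent unbounded , ¬interpolation unbounded ,
  λ (_ , modelCompletion) → ¬modelCompletion unbounded modelCompletion
  where
  open NoModelCompletion em C variety V⊆RL canonical
  open Main em C variety V⊆RL canonical
  unbounded : ∀ k → ¬ (k ⊢ bound (1+ k))
  unbounded k k⊢ = noStabilisation k (⊢bound⇒stable k k⊢)
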